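{- For every integer $k \geq 2$, every graph $G$ with circumference at most $k$ has a colouring with at most $3\log_2 k$ colours such that every monochromatic component has order at most $k$.
   Context: All graphs are finite and simple. A $c$-colouring of a graph is an arbitrary assignment of one of $c$ colours to each vertex (adjacent vertices may receive the same colour). In a vertex-coloured graph, a monochromatic component is a connected component of the subgraph induced by all the vertices of one colour; its order is its number of vertices. The circumference of a graph $G$ is the length of a longest cycle in $G$ if $G$ contains a cycle, and is $2$ if $G$ is a forest. -}

module Defs where

open import Data.Nat using (ℕ; _≤_)
open import Data.Fin using (Fin)
open import Data.Bool using (Bool; false; T)
open import Data.List using (List; []; _∷_; _++_; length)
open import Data.List.Relation.Unary.All using (All)
open import Data.List.Relation.Unary.Linked using (Linked)
open import Data.List.Relation.Unary.Unique.Propositional using (Unique)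
open import Relation.Binary.PropositionalEquality using (_≡_)

record Graph : Set where
  field
    n      : ℕ
    adj    : Fin n → Fin n → Bool
    symm   : ∀ u v → adj u v ≡ adj v u
    irrefl : ∀ v → adj v v ≡ false

open Graph public

Edge : (G : Graph) → Fin (n G) → Fin (n G) → Set
Edge G u v = T (adj G u v)

IsCycle : (G : Graph) → List (Fin (n G)) → Set
IsCycle G []       = Data.Empty.⊥ where import Data.Empty
IsCycle G (v ∷ vs) =
  (3 ≤ length (v ∷ vs)) × Unique (v ∷ vs) × Linked (Edge G) (v ∷ vs ++ v ∷ [])
  where open import Data.Product using (_×_)

-- circumference ≤ k (for k ≥ 2): every cycle has length at most k.
CircumferenceAtMost : ℕ → Graph → Set
CircumferenceAtMost k G = (cs : List (Fin (n G))) → IsCycle G cs → length cs ≤ k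

data MonoReach (G : Graph) {c : ℕ} (f : Fin (n G) → Fin c) : Fin (n G) → Fin (n G) → Set where
  here : ∀ v → MonoReach G f v v
  step : ∀ u w v → Edge G u w → f u ≡ f w → MonoReach G f w v → MonoReach G f u v

ComponentOrderAtMost : (G : Graph) {c : ℕ} → (Fin (n G) → Fin c) → Fin (n G) → ℕ → Set
ComponentOrderAtMost G f v k =
  (us : List (Fin (n G))) → Unique us → All (MonoReach G f v) us → length us ≤ k

{-# OPTIONS --safe #-}
-- With 2^L ≤ k < 2^(L+1), the colouring uses 3L colours. The induction is on a stronger statement:
-- an adjacent pair a , b (or a single vertex a = b) may be precoloured arbitrarily, and no other
-- vertex joins their monochromatic components. If the graph has a separation of order at most two,
-- colour the side containing a , b and then the other side with the separator {x , y} precoloured;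
-- the virtual edge xy does not raise the circumference, since it can be replaced by a path through
-- the opposite side. Otherwise let C be a cycle of maximal length k ≥ 4. Two disjoint cycles C and B
-- are joined by three disjoint paths (Menger), and rerouting along the three pairs of paths yields
-- cycles of total length at least 2|C| + 2|B| + 6, whence |B| < k/2. So a, b and C take three new
-- colours, and the remaining graph has circumference at most k/2 and needs only 3(L - 1).
module Submission where

open import Defs
open import Data.Bool using (if_then_else_; T)
open import Data.Bool.Properties using (T?)
open import Data.Empty using (⊥-elim; ⊥)
open import Data.Fin as Fin using (Fin; zero; suc; punchOut; inject≤; punchIn)
open import Data.Fin.Properties using (injective⇒≤; any?; punchOut-injective; inject≤-injective; punchIn-injective; punchInᵢ≢i; punchIn-punchOut) renaming (_≟_ to _≟ᶠ_)
open import Data.List using (List; []; _∷_; _++_; length; lookup; filter; allFin; cartesianProduct)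
open import Data.List.Membership.Propositional using (_∈_; _∉_; find; lose)
open import Data.List.Membership.Propositional.Properties using (∈-++⁺ˡ; ∈-++⁺ʳ; ∈-++⁻; ∈-lookup; ∈-filter⁺; ∈-filter⁻; ∈-allFin; ∈-cartesianProduct⁺)
open import Data.List.Properties using (length-++; ++-assoc; filter-notAll)
open import Data.List.Relation.Binary.Disjoint.Propositional using (Disjoint)
open import Data.List.Relation.Binary.Permutation.Propositional using (_↭_; ↭⇒↭ₛ; ↭-sym; ↭-trans; ↭-refl; ↭-reflexive)
open import Data.List.Relation.Binary.Permutation.Propositional.Properties using (∈-resp-↭; ↭-length; ++-comm; ++⁺ʳ)
import Data.List.Relation.Binary.Permutation.Setoid.Properties as Permₛ
open import Data.List.Relation.Binary.Subset.Propositional using (_⊆_)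
open import Data.List.Relation.Unary.All as All using (All; []; _∷_; all?)
open import Data.List.Relation.Unary.All.Properties using (¬Any⇒All¬; ¬All⇒Any¬)
open import Data.List.Relation.Unary.AllPairs using ([]; _∷_)
open import Data.List.Relation.Unary.Any as Any using (here; there; index; Any)
open import Data.List.Relation.Unary.Any.Properties using (lookup-index)
open import Data.List.Relation.Unary.Linked using (Linked; []; [-]; _∷_)
open import Data.List.Relation.Unary.Unique.Propositional using (Unique)
open import Data.List.Relation.Unary.Unique.Propositional.Properties as Uniqueₚ using (Unique[x∷xs]⇒x∉xs)
open import Data.Nat using (ℕ; _≤_; suc; zero; _<_; _<?_; s≤s; z≤n; _+_; _*_; _≤?_; _^_; ⌊_/2⌋)
open import Data.Nat.Logarithm using (⌊log₂_⌋; ⌊log₂⌋-mono-≤; ⌊log₂[2^n]⌋≡n)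
open import Data.Nat.Properties using (≤-antisym; ≮⇒≥; 1+n≰n; +-mono-≤; +-monoʳ-≤; ≤-trans; ≤-reflexive; suc-injective; module ≤-Reasoning; +-comm; ≤-pred; ≤∧≢⇒<; ≰⇒>; +-monoʳ-<; ≤-refl; <-≤-trans; ≤-<-trans; <⇒≤; <⇒≱; n≤1+n; *-cancelˡ-<; +-cancelˡ-≤; ⌊n/2⌋≤n; ^-*-assoc; ^-monoˡ-≤; m≤m+n; ⌊n/2⌋-mono)
open import Data.Nat.Tactic.RingSolver using (solve-∀)
open import Data.Product using (Σ; ∃; ∃₂; _×_; _,_; proj₁; proj₂; map₂)
open import Data.Sum using (_⊎_; inj₁; inj₂; swap)
open import Data.Unit using (tt)
open import Function using (_∘_; id; const)
open import Relation.Binary.Definitions using (DecidableEquality; Symmetric) renaming (Decidable to Decidable₂)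
open import Relation.Binary.PropositionalEquality using (_≡_; _≢_; refl; sym; trans; cong; subst; ≢-sym; cong₂)
open import Relation.Binary.PropositionalEquality.Properties using (setoid)
open import Relation.Nullary using (¬_; Dec; yes; no; does)
open import Relation.Nullary.Decidable using (_×-dec_; _⊎-dec_; ¬?; map′; dec-true; dec-false)
open import Relation.Unary using (Decidable)

-- The obstacle is pasting along a separator `{x , y}`: colourings of the two sides may disagree
-- there, and monochromatic components may merge across it. Precolouring cures the first, isolation
-- the second. The precoloured pair has to be adjacent because an edge lies within one side of every
-- separation; this is also what the virtual edge secures for `x` and `y`. Three new colours are the
-- price of a layer because `a` and `b` may carry two different prescribed colours and `C` must
-- avoid both. Three paths between the cycles are what halves the circumference. Two paths with both
-- pairs of arcs would yield |B| ≤ k - 4 only; with three, each pair of ends is joined by the arc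
-- through the third end, which counts every edge of either cycle twice. For `k` at most 3 nothing
-- is halved: either all vertices lie on a cycle of length `k`, which takes one colour, or the
-- component of a vertex off the cycle is attached to it at one vertex at most. A graph without a
-- cycle of length `k` is treated with a smaller `k`.

variable
  V : Set
  R R′ : V → V → Set
  u v w x y z : V
  xs ys zs : List V

-- Repetition-free lists and walks

Unique-resp-↭ : xs ↭ ys → Unique xs → Unique ys
Unique-resp-↭ p = Permₛ.Unique-resp-↭ (setoid _) (↭⇒↭ₛ p)

∉-unique : x ∉ xs → Unique xs → Unique (x ∷ xs)
∉-unique x∉ un = ¬Any⇒All¬ _ x∉ ∷ un

unique-++ˡ : ∀ (xs : List V) {ys} → Unique (xs ++ ys) → Unique xs
unique-++ˡ []       un         = []
unique-++ˡ (x ∷ xs) un@(_ ∷ q) = ∉-unique (λ x∈ → Unique[x∷xs]⇒x∉xs un (∈-++⁺ˡ x∈)) (unique-++ˡ xs q)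

unique-++ʳ : ∀ (xs : List V) {ys} → Unique (xs ++ ys) → Unique ys
unique-++ʳ []       un      = un
unique-++ʳ (x ∷ xs) (_ ∷ q) = unique-++ʳ xs q

unique-disjoint : ∀ (xs : List V) {ys} → Unique (xs ++ ys) → Disjoint xs ys
unique-disjoint (x ∷ xs) un      (here refl , b) = Unique[x∷xs]⇒x∉xs un (∈-++⁺ʳ xs b)
unique-disjoint (x ∷ xs) (_ ∷ q) (there a , b)   = unique-disjoint xs q (a , b)

lookup-injective : Unique xs → ∀ i j → lookup xs i ≡ lookup xs j → i ≡ j
lookup-injective {xs = x ∷ xs} un      Fin.zero    Fin.zero    eq = refl
lookup-injective {xs = x ∷ xs} un      Fin.zero    (Fin.suc j) eq = ⊥-elim (Unique[x∷xs]⇒x∉xs un (subst (_∈ xs) (sym eq) (∈-lookup j)))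
lookup-injective {xs = x ∷ xs} un      (Fin.suc i) Fin.zero    eq = ⊥-elim (Unique[x∷xs]⇒x∉xs un (subst (_∈ xs) eq (∈-lookup i)))
lookup-injective {xs = x ∷ xs} (_ ∷ q) (Fin.suc i) (Fin.suc j) eq = cong Fin.suc (lookup-injective q i j eq)

unique-⊆-length : Unique xs → xs ⊆ ys → length xs ≤ length ys
unique-⊆-length {xs = xs} {ys = ys} un sub = injective⇒≤ {f = f} inj
  where
  f : Fin (length xs) → Fin (length ys)
  f i = index (sub (∈-lookup i))
  f-lookup : ∀ i → lookup xs i ≡ lookup ys (f i)
  f-lookup i = lookup-index (sub (∈-lookup i))
  inj : ∀ {i j} → f i ≡ f j → i ≡ j
  inj {i} {j} eq = lookup-injective un i j
    (trans (f-lookup i) (trans (cong (lookup ys) eq) (sym (f-lookup j))))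

-- The list holds the vertices of the walk except the first one, so that a cycle is a closed walk
-- with a repetition-free list, and concatenation of walks is concatenation of lists.
data Walk {V : Set} (R : V → V → Set) : V → List V → V → Set where
  []  : ∀ {u} → Walk R u [] u
  _∷_ : ∀ {u v w xs} → R u w → Walk R w xs v → Walk R u (w ∷ xs) v

infixr 5 _⊙_
_⊙_ : Walk R u xs v → Walk R v ys w → Walk R u (xs ++ ys) w
[]      ⊙ q = q
(r ∷ p) ⊙ q = r ∷ (p ⊙ q)

restart : u ≡ v → Walk R u xs w → Walk R v xs w
restart refl p = p

map-walk : (∀ {u v} → R u v → R′ u v) → Walk R u xs v → Walk R′ u xs v
map-walk f []      = []
map-walk f (r ∷ p) = f r ∷ map-walk f p

end∈ : Walk R u xs v → v ∈ u ∷ xs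
end∈ []      = here refl
end∈ (_ ∷ p) = there (end∈ p)

end∈′ : Walk R u xs v → u ≢ v → v ∈ xs
end∈′ []      u≢v = ⊥-elim (u≢v refl)
end∈′ (_ ∷ p) _   = end∈ p

end∈ᶜ : Walk R u (x ∷ xs) v → v ∈ x ∷ xs
end∈ᶜ (_ ∷ p) = end∈ p

cut : Walk R u xs v → z ∈ u ∷ xs → ∃₂ λ ps qs → Walk R u ps z × Walk R z qs v × ps ++ qs ≡ xs
cut p       (here refl) = [] , _ , [] , p , refl
cut (r ∷ p) (there z∈)  with ps , qs , p₁ , p₂ , eq ← cut p z∈ = _ ∷ ps , qs , r ∷ p₁ , p₂ , cong (_ ∷_) eq

cut-⊆ˡ : ∀ {V : Set} {u : V} {ps qs xs} → ps ++ qs ≡ xs → u ∷ ps ⊆ u ∷ xs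
cut-⊆ˡ refl (here e)  = here e
cut-⊆ˡ refl (there m) = there (∈-++⁺ˡ m)

cut-⊆ʳ : ∀ {ps qs} → Walk R u ps z → ps ++ qs ≡ xs → z ∷ qs ⊆ u ∷ xs
cut-⊆ʳ {ps = ps} p refl (here refl) = cut-⊆ˡ {ps = ps} refl (end∈ p)
cut-⊆ʳ {ps = ps} p refl (there m)   = there (∈-++⁺ʳ ps m)

step-into : Walk R u xs v → z ∈ xs → ∃ λ w → R w z
step-into (r ∷ p) (here refl) = _ , r
step-into (r ∷ p) (there z∈)  = step-into p z∈

⊙-⊆ : Walk R u xs v → ∀ {ys} → z ∈ u ∷ xs ++ ys → z ∈ u ∷ xs ⊎ z ∈ v ∷ ys
⊙-⊆ {xs = xs} p z∈ with ∈-++⁻ (_ ∷ xs) z∈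
... | inj₁ a = inj₁ a
... | inj₂ b = inj₂ (there b)

module _ (R-sym : Symmetric R) where

  reverse-walk : Walk R u xs v → ∃ λ ys → Walk R v ys u × v ∷ ys ↭ u ∷ xs
  reverse-walk []                  = [] , [] , ↭-refl
  reverse-walk {u = u} (r ∷ p) with ys , q , perm ← reverse-walk p =
    ys ++ u ∷ [] , (q ⊙ (R-sym r ∷ [])) , ↭-trans (++⁺ʳ (u ∷ []) perm) (++-comm _ (u ∷ []))

module _ (_≟_ : DecidableEquality V) where
  open import Data.List.Membership.DecPropositional _≟_ using (_∈?_)

  simple-from : {R : V → V → Set} → Walk R u xs v → Unique (u ∷ xs) → z ∈ u ∷ xs →
                ∃ λ ys → Walk R z ys v × Unique (z ∷ ys) × z ∷ ys ⊆ u ∷ xs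
  simple-from p       un       (here refl) = _ , p , un , id
  simple-from (r ∷ p) (_ ∷ un) (there z∈) with ys , q , un′ , sub ← simple-from p un z∈ =
    ys , q , un′ , there ∘ sub

  simplify : {R : V → V → Set} → Walk R u xs v → ∃ λ ys → Walk R u ys v × Unique (u ∷ ys) × u ∷ ys ⊆ u ∷ xs
  simplify []      = [] , [] , [] ∷ [] , id
  simplify {u = u} (_∷_ {w = w} r p) with ys , q , un , sub ← simplify p | u ∈? (w ∷ ys)
  ... | no u∉ = w ∷ ys , r ∷ q , ∉-unique u∉ un , λ { (here e) → here e ; (there m) → there (sub m) }
  ... | yes u∈ with zs , s , un′ , sub′ ← simple-from q un u∈ = zs , s , un′ , there ∘ sub ∘ sub′

cut-at-end : ∀ {ps qs} → Unique (u ∷ ps ++ qs) → Walk R z qs v → v ∈ u ∷ ps → z ≡ v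
cut-at-end           un []      v∈ = refl
cut-at-end {ps = ps} un (r ∷ q) v∈ = ⊥-elim (unique-disjoint (_ ∷ ps) un (v∈ , end∈ q))

cut-at-start : ∀ {ps qs} → Unique (u ∷ ps ++ qs) → Walk R u ps z → u ∈ z ∷ qs → z ≡ u
cut-at-start           un []      u∈         = refl
cut-at-start           un p       (here e)   = sym e
cut-at-start {ps = ps} un p       (there u∈) = ⊥-elim (unique-disjoint (_ ∷ ps) un (here refl , u∈))

variable
  N m : ℕ

injective⇒surjective : (f : Fin m → Fin m) → (∀ {i j} → f i ≡ f j → i ≡ j) → ∀ j → ∃ λ i → f i ≡ j
injective⇒surjective {suc m} f inj j with any? (λ i → f i ≟ᶠ j)
... | yes found = found
... | no  none  = ⊥-elim (1+n≰n (injective⇒≤ {f = λ i → punchOut (j≢ i)} (inj ∘ punchOut-injective (j≢ _) (j≢ _))))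
  where
  j≢ : ∀ i → j ≢ f i
  j≢ i eq = none (i , sym eq)

-- Menger's theorem

-- The ends of the walk count, and a walk may have length 0, so `S` contains every common vertex of
-- `A` and `B`.
Separates : {V : Set} → (V → V → Set) → (V → Set) → (V → Set) → List V → Set
Separates R A B S = ∀ {u v xs} → A u → B v → Walk R u xs v → Any (_∈ S) (u ∷ xs)

record Linkage {V : Set} (R : V → V → Set) (A B : V → Set) (m : ℕ) : Set where
  field
    source   : Fin m → V
    target   : Fin m → V
    trail    : Fin m → List V
    walk     : ∀ i → Walk R (source i) (trail i) (target i)
    simple   : ∀ i → Unique (source i ∷ trail i)
    source∈  : ∀ i → A (source i)
    target∈  : ∀ i → B (target i)
    disjoint : ∀ i j {z} → z ∈ source i ∷ trail i → z ∈ source j ∷ trail j → i ≡ j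

open Linkage

map-linkage : ∀ {V : Set} {R R′ : V → V → Set} {A B} → (∀ {u v} → R u v → R′ u v) → Linkage R A B m → Linkage R′ A B m
map-linkage f P = record
  { source = source P ; target = target P ; trail = trail P ; walk = map-walk f ∘ walk P ; simple = simple P
  ; source∈ = source∈ P ; target∈ = target∈ P ; disjoint = disjoint P }

-- Menger's theorem is proved for directed graphs, by induction on the list of arcs; an undirected
-- edge appears as two arcs.
Edges : {V : Set} → List (V × V) → V → V → Set
Edges E u v = (u , v) ∈ E

before-edge : ∀ {V : Set} {E} {x y u v : V} {xs} → Walk (Edges ((x , y) ∷ E)) u xs v →
              Walk (Edges E) u xs v ⊎ ∃ λ ps → Walk (Edges E) u ps x × u ∷ ps ⊆ u ∷ xs
before-edge []              = inj₁ []
before-edge (here refl ∷ p) = inj₂ ([] , [] , λ { (here e) → here e })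
before-edge (there r ∷ p) with before-edge p
... | inj₁ q              = inj₁ (r ∷ q)
... | inj₂ (ps , q , sub) = inj₂ (_ ∷ ps , r ∷ q , λ { (here e) → here e ; (there m) → there (sub m) })

-- The tail is examined before the head, so that the walk is cut after the last use of the new arc.
after-edge : ∀ {V : Set} {E} {x y u v : V} {xs} → Walk (Edges ((x , y) ∷ E)) u xs v →
             Walk (Edges E) u xs v ⊎ ∃ λ qs → Walk (Edges E) y qs v × y ∷ qs ⊆ u ∷ xs
after-edge []      = inj₁ []
after-edge (r ∷ p) with after-edge p
after-edge (r ∷ p)         | inj₂ (qs , q , sub) = inj₂ (qs , q , there ∘ sub)
after-edge (here refl ∷ p) | inj₁ q              = inj₂ (_ , q , there)
after-edge (there r ∷ p)   | inj₁ q              = inj₁ (r ∷ q)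

-- Göring's induction: a separator S that is tight once the edge (x , y) is removed splits the
-- problem into linking A to S ∪ {x} and S ∪ {y} to B.
module Glue {V : Set} (_≟_ : (u v : V) → Dec (u ≡ v)) {E : List (V × V)} {A B : V → Set} (x y : V) (S : List V)
            (sep : Separates (Edges E) A B S)
            (P : Linkage (Edges E) A (_∈ x ∷ S) (length (x ∷ S)))
            (Q : Linkage (Edges E) (_∈ y ∷ S) B (length (y ∷ S))) where

  M : ℕ
  M = length (x ∷ S)

  endP : Fin M → Fin M
  endP i = index (target∈ P i)

  startQ : Fin M → Fin M
  startQ i = index (source∈ Q i)

  endP-inj : ∀ {i j} → endP i ≡ endP j → i ≡ j
  endP-inj {i} {j} eq = disjoint P i j (end∈ (walk P i)) (subst (_∈ _) (sym same) (end∈ (walk P j)))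
    where
    same : target P i ≡ target P j
    same = trans (lookup-index (target∈ P i)) (trans (cong (lookup (x ∷ S)) eq) (sym (lookup-index (target∈ P j))))

  startQ-inj : ∀ {i j} → startQ i ≡ startQ j → i ≡ j
  startQ-inj {i} {j} eq = disjoint Q i j (here refl) (here same)
    where
    same : source Q i ≡ source Q j
    same = trans (lookup-index (source∈ Q i)) (trans (cong (lookup (y ∷ S)) eq) (sym (lookup-index (source∈ Q j))))

  -- `M` disjoint paths with ends in a list of `M` entries use every entry once; `π j` and `ρ j` are
  -- the paths at entry `j`. Entry `suc i` is the same vertex of `S` in `x ∷ S` and in `y ∷ S`,
  -- while at entry `zero` the new arc bridges `x` and `y`.
  π ρ : Fin M → Fin M
  π j = proj₁ (injective⇒surjective endP endP-inj j)
  ρ j = proj₁ (injective⇒surjective startQ startQ-inj j)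

  π-end : ∀ j → target P (π j) ≡ lookup (x ∷ S) j
  π-end j = trans (lookup-index (target∈ P (π j))) (cong (lookup (x ∷ S)) (proj₂ (injective⇒surjective endP endP-inj j)))

  ρ-start : ∀ j → source Q (ρ j) ≡ lookup (y ∷ S) j
  ρ-start j = trans (lookup-index (source∈ Q (ρ j))) (cong (lookup (y ∷ S)) (proj₂ (injective⇒surjective startQ startQ-inj j)))

  π-inj : ∀ {i j} → π i ≡ π j → i ≡ j
  π-inj {i} {j} eq = trans (sym (proj₂ (injective⇒surjective endP endP-inj i)))
                     (trans (cong endP eq) (proj₂ (injective⇒surjective endP endP-inj j)))

  ρ-inj : ∀ {i j} → ρ i ≡ ρ j → i ≡ j
  ρ-inj {i} {j} eq = trans (sym (proj₂ (injective⇒surjective startQ startQ-inj i)))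
                     (trans (cong startQ eq) (proj₂ (injective⇒surjective startQ startQ-inj j)))

  onP : ∀ {i j z} → z ∈ source P (π i) ∷ trail P (π i) → z ≡ lookup (x ∷ S) j → i ≡ j
  onP {i} {j} z∈ eq = π-inj (disjoint P _ _ z∈ (subst (_∈ _) (trans (π-end j) (sym eq)) (end∈ (walk P (π j)))))

  onQ : ∀ {i j z} → z ∈ source Q (ρ i) ∷ trail Q (ρ i) → z ≡ lookup (y ∷ S) j → i ≡ j
  onQ {i} {j} z∈ eq = ρ-inj (disjoint Q _ _ z∈ (here (trans eq (sym (ρ-start j)))))

  -- Following the first path to `z` and the second from there gives a walk from `A` to `B` without
  -- the new arc, which meets `S`. The paths touch `S` only at the end, respectively at the start,
  -- so that the vertex met is `z` itself and determines both indices.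
  cross : ∀ i j {z} → z ∈ source P (π i) ∷ trail P (π i) → z ∈ source Q (ρ j) ∷ trail Q (ρ j) → i ≡ j
  cross i j {z} z∈P z∈Q
    with ps , ps′ , p₁ , p₂ , eqP ← cut (walk P (π i)) z∈P
       | qs , qs′ , q₁ , q₂ , eqQ ← cut (walk Q (ρ j)) z∈Q
    with w , w∈ , w∈S ← find (sep (source∈ P (π i)) (target∈ Q (ρ j)) (p₁ ⊙ q₂))
    with ⊙-⊆ p₁ w∈
  ... | inj₁ w∈P = trans i≡ (sym (onQ z∈Q (trans z≡w w≡)))
    where
    w≡ = lookup-index w∈S
    i≡ : i ≡ suc (index w∈S)
    i≡ = onP (cut-⊆ˡ eqP w∈P) w≡
    w≡end : w ≡ target P (π i)
    w≡end = trans w≡ (sym (trans (π-end i) (cong (lookup (x ∷ S)) i≡)))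
    z≡w : z ≡ w
    z≡w = trans (cut-at-end (subst (λ l → Unique (_ ∷ l)) (sym eqP) (simple P (π i))) p₂ (subst (_∈ _) w≡end w∈P)) (sym w≡end)
  ... | inj₂ w∈Q = trans (onP z∈P (trans z≡w w≡)) (sym j≡)
    where
    w≡ = lookup-index w∈S
    j≡ : j ≡ suc (index w∈S)
    j≡ = onQ (cut-⊆ʳ q₁ eqQ w∈Q) w≡
    w≡start : w ≡ source Q (ρ j)
    w≡start = trans w≡ (sym (trans (ρ-start j) (cong (lookup (y ∷ S)) j≡)))
    z≡w : z ≡ w
    z≡w = trans (cut-at-start (subst (λ l → Unique (_ ∷ l)) (sym eqQ) (simple Q (ρ j))) q₁ (subst (_∈ _) w≡start w∈Q)) (sym w≡start)

  Joined : Fin M → Set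
  Joined j = ∃ λ l → Walk (Edges ((x , y) ∷ E)) (source P (π j)) l (target Q (ρ j)) × Unique (source P (π j) ∷ l) ×
             (∀ {z} → z ∈ source P (π j) ∷ l → z ∈ source P (π j) ∷ trail P (π j) ⊎ z ∈ source Q (ρ j) ∷ trail Q (ρ j))

  simplified : ∀ j {l} → Walk (Edges ((x , y) ∷ E)) (source P (π j)) l (target Q (ρ j)) →
               (∀ {z} → z ∈ source P (π j) ∷ l → z ∈ source P (π j) ∷ trail P (π j) ⊎ z ∈ source Q (ρ j) ∷ trail Q (ρ j)) →
               Joined j
  simplified j p sub with l , q , un , sub′ ← simplify _≟_ p = l , q , un , sub ∘ sub′

  joined : ∀ j → Joined j
  joined zero = simplified zero
    (map-walk there (walk P (π zero)) ⊙
     restart (sym (π-end zero)) (subst (λ z → Edges _ x z) (sym (ρ-start zero)) (here refl) ∷ map-walk there (walk Q (ρ zero))))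
    λ z∈ → sub (⊙-⊆ (walk P (π zero)) z∈)
    where
    sub : ∀ {z} → z ∈ source P (π zero) ∷ trail P (π zero) ⊎ z ∈ target P (π zero) ∷ source Q (ρ zero) ∷ trail Q (ρ zero) →
          z ∈ source P (π zero) ∷ trail P (π zero) ⊎ z ∈ source Q (ρ zero) ∷ trail Q (ρ zero)
    sub (inj₁ a)           = inj₁ a
    sub (inj₂ (here refl)) = inj₁ (end∈ (walk P (π zero)))
    sub (inj₂ (there b))   = inj₂ b
  joined (suc j) = simplified (suc j)
    (map-walk there (walk P (π (suc j))) ⊙ restart (sym meet) (map-walk there (walk Q (ρ (suc j)))))
    λ z∈ → sub (⊙-⊆ (walk P (π (suc j))) z∈)
    where
    meet : target P (π (suc j)) ≡ source Q (ρ (suc j))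
    meet = trans (π-end (suc j)) (sym (ρ-start (suc j)))
    sub : ∀ {z} → z ∈ source P (π (suc j)) ∷ trail P (π (suc j)) ⊎ z ∈ target P (π (suc j)) ∷ trail Q (ρ (suc j)) →
          z ∈ source P (π (suc j)) ∷ trail P (π (suc j)) ⊎ z ∈ source Q (ρ (suc j)) ∷ trail Q (ρ (suc j))
    sub (inj₁ a)           = inj₁ a
    sub (inj₂ (here refl)) = inj₁ (end∈ (walk P (π (suc j))))
    sub (inj₂ (there b))   = inj₂ (there b)

  glued : Linkage (Edges ((x , y) ∷ E)) A B M
  glued = record
    { source   = source P ∘ π
    ; target   = target Q ∘ ρ
    ; trail    = proj₁ ∘ joined
    ; walk     = λ j → proj₁ (proj₂ (joined j))
    ; simple   = λ j → proj₁ (proj₂ (proj₂ (joined j)))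
    ; source∈  = source∈ P ∘ π
    ; target∈  = target∈ Q ∘ ρ
    ; disjoint = λ i j z∈i z∈j → disj i j (proj₂ (proj₂ (proj₂ (joined i))) z∈i) (proj₂ (proj₂ (proj₂ (joined j))) z∈j)
    }
    where
    disj : ∀ i j {z} → z ∈ source P (π i) ∷ trail P (π i) ⊎ z ∈ source Q (ρ i) ∷ trail Q (ρ i) →
           z ∈ source P (π j) ∷ trail P (π j) ⊎ z ∈ source Q (ρ j) ∷ trail Q (ρ j) → i ≡ j
    disj i j (inj₁ a) (inj₁ b) = π-inj (disjoint P _ _ a b)
    disj i j (inj₁ a) (inj₂ b) = cross i j a b
    disj i j (inj₂ a) (inj₁ b) = sym (cross j i b a)
    disj i j (inj₂ a) (inj₂ b) = ρ-inj (disjoint Q _ _ a b)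

⊆-any : ∀ {V : Set} {P : V → Set} {xs ys : List V} → xs ⊆ ys → Any P xs → Any P ys
⊆-any sub a with _ , z∈ , pz ← find a = lose (sub z∈) pz

module _ {x y : Fin N} {E : List (Fin N × Fin N)} {A B : Fin N → Set} where

  separates-∷ : ∀ {S} → Separates (Edges E) A B S → Separates (Edges ((x , y) ∷ E)) A B (x ∷ S)
  separates-∷ sep a b p with before-edge p
  ... | inj₁ q              with _ , z∈ , z∈S ← find (sep a b q) = lose z∈ (there z∈S)
  ... | inj₂ (ps , q , sub) = lose (sub (end∈ q)) (here refl)

  separates-before : ∀ {S T} → Separates (Edges E) A B S → Separates (Edges E) A (_∈ x ∷ S) T →
                     Separates (Edges ((x , y) ∷ E)) A B T
  separates-before sepS sepT a b p with before-edge p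
  ... | inj₂ (ps , q , sub) = ⊆-any sub (sepT a (here refl) q)
  ... | inj₁ q with z , z∈ , z∈S ← find (sepS a b q) with ps , qs , q₁ , q₂ , eq ← cut q z∈ =
    ⊆-any (cut-⊆ˡ eq) (sepT a (there z∈S) q₁)

  separates-after : ∀ {S T} → Separates (Edges E) A B S → Separates (Edges E) (_∈ y ∷ S) B T →
                    Separates (Edges ((x , y) ∷ E)) A B T
  separates-after sepS sepT a b p with after-edge p
  ... | inj₂ (ps , q , sub) = ⊆-any sub (sepT (here refl) b q)
  ... | inj₁ q with z , z∈ , z∈S ← find (sepS a b q) with ps , qs , q₁ , q₂ , eq ← cut q z∈ =
    ⊆-any (cut-⊆ʳ q₁ eq) (sepT (there z∈S) b q₂)

menger-edges : (E : List (Fin N × Fin N)) {A B : Fin N → Set} → Decidable A → Decidable B → ∀ m →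
               (∃ λ S → length S < m × Separates (Edges E) A B S) ⊎ Linkage (Edges E) A B m
menger-edges {N} [] {A} {B} A? B? m with length (filter (λ v → A? v ×-dec B? v) (allFin N)) <? m
... | yes small = inj₁ (_ , small , λ { a b [] → here (∈-filter⁺ (λ v → A? v ×-dec B? v) (∈-allFin _) (a , b)) })
... | no  large = inj₂ record
  { source = pick ; target = pick ; trail = λ _ → [] ; walk = λ _ → [] ; simple = λ _ → [] ∷ []
  ; source∈ = proj₁ ∘ pick∈ ; target∈ = proj₂ ∘ pick∈
  ; disjoint = λ { i j (here refl) (here eq) → inject≤-injective m≤ m≤ i j (lookup-injective unique _ _ eq) } }
  where
  common : List (Fin N)
  common = filter (λ v → A? v ×-dec B? v) (allFin N)
  m≤ : m ≤ length common
  m≤ = ≮⇒≥ large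
  unique : Unique common
  unique = Uniqueₚ.filter⁺ (λ v → A? v ×-dec B? v) (Uniqueₚ.allFin⁺ N)
  pick : Fin m → Fin N
  pick i = lookup common (inject≤ i m≤)
  pick∈ : ∀ i → A (pick i) × B (pick i)
  pick∈ i = proj₂ (∈-filter⁻ (λ v → A? v ×-dec B? v) {xs = allFin N} (∈-lookup (inject≤ i m≤)))
menger-edges ((x , y) ∷ E) A? B? m with menger-edges E A? B? m
... | inj₂ P = inj₂ (map-linkage there P)
... | inj₁ (S , S<m , sepS) with length (x ∷ S) <? m
... | yes S+1<m = inj₁ (x ∷ S , S+1<m , separates-∷ sepS)
-- Now `x ∷ S` and `y ∷ S` have exactly `m` entries, as the pasting of two linkages of order `m`
-- requires.
... | no  S+1≮m with refl ← ≤-antisym S<m (≮⇒≥ S+1≮m)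
  with menger-edges E A? (_∈? (x ∷ S)) m | menger-edges E (_∈? (y ∷ S)) B? m
  where open import Data.List.Membership.DecPropositional _≟ᶠ_ using (_∈?_)
... | inj₁ (T , T<m , sepT) | _                     = inj₁ (T , T<m , separates-before sepS sepT)
... | inj₂ P                | inj₁ (T , T<m , sepT) = inj₁ (T , T<m , separates-after sepS sepT)
... | inj₂ P                | inj₂ Q                = inj₂ (Glue.glued _≟ᶠ_ x y S sepS P Q)

menger : {R : Fin N → Fin N → Set} → Decidable₂ R → {A B : Fin N → Set} → Decidable A → Decidable B → ∀ m →
         (∃ λ S → length S < m × Separates R A B S) ⊎ Linkage R A B m
menger {N} {R} R? A? B? m with menger-edges edges A? B? m
  where edges = filter (λ e → R? (proj₁ e) (proj₂ e)) (cartesianProduct (allFin N) (allFin N))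
... | inj₁ (S , S<m , sep) = inj₁ (S , S<m , λ a b p → sep a b (map-walk into p))
  where
  into : ∀ {u v} → R u v → Edges (filter (λ e → R? (proj₁ e) (proj₂ e)) (cartesianProduct (allFin N) (allFin N))) u v
  into r = ∈-filter⁺ (λ e → R? (proj₁ e) (proj₂ e)) (∈-cartesianProduct⁺ (∈-allFin _) (∈-allFin _)) r
... | inj₂ P = inj₂ (map-linkage (λ e → proj₂ (∈-filter⁻ (λ e → R? (proj₁ e) (proj₂ e)) {xs = cartesianProduct (allFin N) (allFin N)} e)) P)

-- The case `m = 1` of Menger: a separator with no vertex means that there is no walk.
reach? : {R : Fin N → Fin N → Set} → Decidable₂ R → {A : Fin N → Set} → Decidable A → ∀ v →
         Dec (∃₂ λ u xs → A u × Walk R u xs v)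
reach? R? A? v with menger R? A? (_≟ᶠ v) 1
... | inj₁ ([] , _ , sep) = no λ { (u , xs , a , p) → ∉[] (sep a refl p) }
  where
  ∉[] : ∀ {xs : List (Fin _)} → ¬ Any (_∈ []) xs
  ∉[] (there a) = ∉[] a
... | inj₁ (_ ∷ _ , s≤s () , _)
... | inj₂ P = yes (source P zero , trail P zero , source∈ P zero , subst (Walk _ _ _) (target∈ P zero) (walk P zero))

-- Cycles joined by disjoint paths

-- This also counts an edge traversed back and forth as a cycle of length 2, and a loop as one of length 1.
Circ : {V : Set} → (V → V → Set) → ℕ → Set
Circ R k = ∀ {v xs} → Walk R v xs v → Unique xs → length xs ≤ k

rotate : Walk R v xs v → z ∈ xs → ∃ λ ys → Walk R z ys z × ys ↭ xs
rotate p z∈ with ps , qs , p₁ , p₂ , refl ← cut p (there z∈) = qs ++ ps , (p₂ ⊙ p₁) , ++-comm qs ps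

-- As `inner` omits only the first vertex, `ℓ` is the number of edges.
record Arc {V : Set} (R : V → V → Set) (I : List V) (u v : V) (ℓ : ℕ) : Set where
  constructor arc
  field
    {inner} : List V
    path    : Walk R u inner v
    unique  : Unique (u ∷ inner)
    within  : u ∷ inner ⊆ I
    size    : length inner ≡ ℓ

reverse-arc : ∀ {I ℓ} → Symmetric R → Arc R I u v ℓ → Arc R I v u ℓ
reverse-arc R-sym (arc p un sub size) with ys , q , perm ← reverse-walk R-sym p =
  arc q (Unique-resp-↭ (↭-sym perm) un) (sub ∘ ∈-resp-↭ perm) (trans (suc-injective (↭-length perm)) size)

arc-of-cycle : ∀ {I ps qs} → Walk R u ps v → Walk R v qs u → u ≢ v → Unique (ps ++ qs) → ps ++ qs ⊆ I →
               Arc R I u v (length ps)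
arc-of-cycle {u = u} {ps = ps} p q u≢v un sub = arc p
  (∉-unique (λ u∈ps → unique-disjoint ps un (u∈ps , u∈qs)) (unique-++ˡ ps un))
  (λ { (here refl) → sub (∈-++⁺ʳ ps u∈qs) ; (there m) → sub (∈-++⁺ˡ m) })
  refl
  where u∈qs = end∈′ q (u≢v ∘ sym)

ThreeArcs : {V : Set} → (V → V → Set) → List V → V → V → V → Set
ThreeArcs R I x y z = ∃₂ λ ℓ₁ ℓ₂ → ∃ λ ℓ₃ → Arc R I x y ℓ₁ × Arc R I x z ℓ₂ × Arc R I y z ℓ₃ × ℓ₁ + ℓ₂ + ℓ₃ ≡ 2 * length I

module _ (R-sym : Symmetric R) where

  two-arcs : Walk R v xs v → Unique xs → x ∈ xs → y ∈ xs → x ≢ y →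
             ∃₂ λ ℓ ℓ′ → Arc R xs x y ℓ × Arc R xs x y ℓ′ × ℓ + ℓ′ ≡ length xs
  two-arcs p un x∈ y∈ x≢y with ys , q , perm ← rotate p x∈
    with ps , qs , q₁ , q₂ , refl ← cut q (there (∈-resp-↭ (↭-sym perm) y∈)) =
    length ps , length qs
    , arc-of-cycle q₁ q₂ x≢y un′ (∈-resp-↭ perm)
    , reverse-arc R-sym (arc-of-cycle q₂ q₁ (≢-sym x≢y) (Unique-resp-↭ (++-comm ps qs) un′) (∈-resp-↭ (↭-trans (++-comm qs ps) perm)))
    , trans (sym (length-++ ps)) (↭-length perm)
    where un′ = Unique-resp-↭ (↭-sym perm) un

  -- Each two of the vertices are joined by the arc through the third. Every one of the three
  -- segments then lies in two of the arcs, whence the factor 2.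
  three-arcs-split : ∀ {I ps qs rs} → Walk R x ps y → Walk R y qs z → Walk R z rs x →
                     x ≢ y → x ≢ z → y ≢ z → Unique I → ps ++ qs ++ rs ↭ I → ThreeArcs R I x y z
  three-arcs-split {I = I} {ps} {qs} {rs} p q r x≢y x≢z y≢z un perm =
    length (qs ++ rs) , length (ps ++ qs) , length (rs ++ ps)
    , reverse-arc R-sym (arc-of-cycle (q ⊙ r) p (≢-sym x≢y) (uniq perm₁) (∈-resp-↭ perm₁))
    , arc-of-cycle (p ⊙ q) r x≢z (uniq perm₂) (∈-resp-↭ perm₂)
    , reverse-arc R-sym (arc-of-cycle (r ⊙ p) q (≢-sym y≢z) (uniq perm₃) (∈-resp-↭ perm₃))
    , lengths
    where
    uniq : ∀ {ls} → ls ↭ _ → Unique ls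
    uniq π = Unique-resp-↭ (↭-sym π) un
    perm₁ = ↭-trans (++-comm (qs ++ rs) ps) perm
    perm₂ = ↭-trans (↭-reflexive (++-assoc ps qs rs)) perm
    perm₃ = ↭-trans (↭-reflexive (++-assoc rs ps qs)) (↭-trans (++-comm rs (ps ++ qs)) perm₂)
    double : ∀ a b c → (b + c) + (a + b) + (c + a) ≡ 2 * (a + (b + c))
    double = solve-∀
    lengths : length (qs ++ rs) + length (ps ++ qs) + length (rs ++ ps) ≡ 2 * length I
    lengths rewrite sym (↭-length perm) | length-++ qs {rs} | length-++ ps {qs} | length-++ rs {ps}
                  | length-++ ps {qs ++ rs} | length-++ qs {rs} = double (length ps) (length qs) (length rs)

  three-arcs : Walk R v xs v → Unique xs → x ∈ xs → y ∈ xs → z ∈ xs → x ≢ y → x ≢ z → y ≢ z → ThreeArcs R xs x y z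
  three-arcs p un x∈ y∈ z∈ x≢y x≢z y≢z with ys , q , perm ← rotate p x∈
    with ps , qs , q₁ , q₂ , refl ← cut q (there (∈-resp-↭ (↭-sym perm) y∈))
    with ∈-++⁻ ps (∈-resp-↭ (↭-sym perm) z∈)
  ... | inj₂ z∈qs with rs , ss , q₂₁ , q₂₂ , refl ← cut q₂ (there z∈qs) =
    three-arcs-split q₁ q₂₁ q₂₂ x≢y x≢z y≢z un perm
  -- The cyclic order is `x`, `z`, `y` here, so `y` and `z` exchange roles.
  ... | inj₁ z∈ps with rs , ss , q₁₁ , q₁₂ , refl ← cut q₁ (there z∈ps)
    with ℓ₁ , ℓ₂ , ℓ₃ , a₁ , a₂ , a₃ , eq ← three-arcs-split q₁₁ q₁₂ q₂ x≢z x≢y (≢-sym y≢z) un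
                                              (↭-trans (↭-reflexive (sym (++-assoc rs ss qs))) perm) =
    ℓ₂ , ℓ₁ , ℓ₃ , a₂ , a₁ , reverse-arc R-sym a₃ , trans (exchange ℓ₂ ℓ₁ ℓ₃) eq
    where
    exchange : ∀ a b c → a + b + c ≡ b + a + c
    exchange = solve-∀

  ear-bound : ∀ {k ℓ C} → Circ R k → Arc R C x y ℓ → Walk R y ys x → Unique ys → (∀ {z} → z ∈ ys → z ∈ C → z ≡ x) →
              ℓ + length ys ≤ k
  ear-bound circ (arc {inner} p un sub refl) q un′ only =
    subst (_≤ _) (length-++ inner) (circ (p ⊙ q) (Uniqueₚ.++⁺ (unique-++ʳ (_ ∷ []) un) un′
      λ { (z∈p , z∈q) → Unique[x∷xs]⇒x∉xs un (subst (_∈ inner) (only z∈q (sub (there z∈p))) z∈p) }))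

-- `T` is the vertex set of the path from which the link is taken; links inherit their disjointness
-- from it.
record Link {V : Set} (R : V → V → Set) (C B T : List V) (c b : V) : Set where
  field
    {inner} : List V
    path    : Walk R c inner b
    unique  : Unique (c ∷ inner)
    within  : c ∷ inner ⊆ T
    meetsˡ  : ∀ {z} → z ∈ c ∷ inner → z ∈ C → z ≡ c
    meetsʳ  : ∀ {z} → z ∈ c ∷ inner → z ∈ B → z ≡ b

reverse-link : ∀ {C B T} → Symmetric R → Link R C B T u v → Link R B C T v u
reverse-link R-sym l with ys , q , perm ← reverse-walk R-sym (Link.path l) = record
  { path = q ; unique = Unique-resp-↭ (↭-sym perm) (Link.unique l) ; within = Link.within l ∘ ∈-resp-↭ perm
  ; meetsˡ = Link.meetsʳ l ∘ ∈-resp-↭ perm ; meetsʳ = Link.meetsˡ l ∘ ∈-resp-↭ perm }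

module _ (_≟_ : DecidableEquality V) where
  open import Data.List.Membership.DecPropositional _≟_ using (_∈?_)

  last-visit : {R : V → V → Set} (C : List V) → Walk R u xs v → Any (_∈ C) (u ∷ xs) →
               ∃₂ λ c ys → c ∈ C × Walk R c ys v × c ∷ ys ⊆ u ∷ xs × (∀ {z} → z ∈ ys → z ∉ C)
  last-visit C [] (here u∈) = _ , [] , u∈ , [] , id , λ ()
  last-visit C p@(_∷_ {xs = xs} r p′) a with Any.any? (_∈? C) (_ ∷ xs)
  ... | yes a′ with c , ys , c∈ , q , sub , no-C ← last-visit C p′ a′ = c , ys , c∈ , q , there ∘ sub , no-C
  last-visit C p (here u∈) | no none = _ , _ , u∈ , p , id , λ z∈ z∈C → none (lose z∈ z∈C)
  last-visit C p (there a) | no none = ⊥-elim (none a)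

  first-visit : {R : V → V → Set} (B : List V) → Walk R u xs v → v ∈ B →
                ∃₂ λ b ys → b ∈ B × Walk R u ys b × ys ⊆ xs × (∀ {z} → z ∈ ys → z ∈ B → z ≡ b)
  first-visit B [] v∈ = _ , [] , v∈ , [] , id , λ ()
  first-visit B (_∷_ {w = w} r p) v∈ with w ∈? B
  ... | yes w∈ = w , w ∷ [] , w∈ , r ∷ [] , (λ { (here e) → here e }) , λ { (here e) _ → e }
  ... | no  w∉ with b , ys , b∈ , q , sub , only ← first-visit B p v∈ =
    b , w ∷ ys , b∈ , r ∷ q , (λ { (here e) → here e ; (there m) → there (sub m) })
    , λ { (here refl) z∈B → ⊥-elim (w∉ z∈B) ; (there m) → only m }

  -- A path of the linkage may visit `C` and `B` repeatedly. The link starts at its last vertex on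
  -- `C` and stops at the first vertex on `B` after that.
  link : {R : V → V → Set} (C B : List V) → Disjoint C B → Walk R u xs v → u ∈ C → v ∈ B →
         ∃₂ λ c b → c ∈ C × b ∈ B × Link R C B (u ∷ xs) c b
  link C B disj p u∈ v∈
    with c , ys , c∈ , p₁ , sub₁ , no-C ← last-visit C p (here u∈)
    with b , zs , b∈ , p₂ , sub₂ , only ← first-visit B p₁ v∈
    with ws , p₃ , un , sub₃ ← simplify _≟_ p₂ =
    c , b , c∈ , b∈ , record
      { path = p₃ ; unique = un ; within = λ z∈ → sub₁ (grow (sub₃ z∈))
      ; meetsˡ = λ z∈ z∈C → onC (sub₃ z∈) z∈C
      ; meetsʳ = λ z∈ z∈B → onB (sub₃ z∈) z∈B }
    where
    grow : c ∷ zs ⊆ c ∷ ys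
    grow (here e)  = here e
    grow (there m) = there (sub₂ m)
    onC : ∀ {z} → z ∈ c ∷ zs → z ∈ C → z ≡ c
    onC (here e)  _   = e
    onC (there m) z∈C = ⊥-elim (no-C (sub₂ m) z∈C)
    onB : ∀ {z} → z ∈ c ∷ zs → z ∈ B → z ≡ b
    onB (here refl) z∈B = ⊥-elim (disj (c∈ , z∈B))
    onB (there m)   z∈B = only m z∈B

∈⇒length>0 : x ∈ xs → 1 ≤ length xs
∈⇒length>0 (here _)  = s≤s z≤n
∈⇒length>0 (there _) = s≤s z≤n

-- The cycle follows `a`, `l′`, then `a′` and `l` backwards. The 2 accounts for the links, each of
-- which has an edge since `C` and `B` are disjoint.
link-cycle : ∀ {k C B T T′ c c′ b b′ ℓ ℓ′} → Symmetric R → Circ R k → Disjoint C B → Disjoint T T′ →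
             c ∈ C → c′ ∈ C → b ∈ B → b′ ∈ B →
             Link R C B T c b → Link R C B T′ c′ b′ → Arc R C c c′ ℓ → Arc R B b b′ ℓ′ → ℓ + ℓ′ + 2 ≤ k
link-cycle {C = C} {B} {c = c} {c′} {b} {b′} {ℓ} {ℓ′} R-sym circ disj disjT c∈ c′∈ b∈ b′∈ l l′ a a′ =
  ≤-trans (subst (_≤ length (X ++ Z′ ++ Y ++ Z)) (cong₂ (λ s t → s + t + 2) (Arc.size a) (Arc.size ra′)) enough)
    (circ (Arc.path a ⊙ Link.path l′ ⊙ Arc.path ra′ ⊙ Link.path rl)
    (Uniqueₚ.++⁺ (unique-++ʳ (_ ∷ []) (Arc.unique a))
      (Uniqueₚ.++⁺ (unique-++ʳ (_ ∷ []) (Link.unique l′))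
        (Uniqueₚ.++⁺ (unique-++ʳ (_ ∷ []) (Arc.unique ra′)) (unique-++ʳ (_ ∷ []) (Link.unique rl)) YZ) Z′YZ) XZ′YZ))
  where
  ra′ = reverse-arc R-sym a′
  rl  = reverse-link R-sym l
  X = Arc.inner a
  Y = Arc.inner ra′
  Z = Link.inner rl
  Z′ = Link.inner l′
  first∉ : ∀ {u z : _} {xs} → Unique (u ∷ xs) → z ∈ xs → z ≢ u
  first∉ un z∈ refl = Unique[x∷xs]⇒x∉xs un z∈
  YZ : Disjoint Y Z
  YZ (y , z) = first∉ (Link.unique rl) z (Link.meetsˡ rl (there z) (Arc.within ra′ (there y)))
  Z′YZ : Disjoint Z′ (Y ++ Z)
  Z′YZ (z′ , yz) with ∈-++⁻ Y yz
  ... | inj₁ y = first∉ (Arc.unique ra′) y (Link.meetsʳ l′ (there z′) (Arc.within ra′ (there y)))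
  ... | inj₂ z = disjT (Link.within rl (there z) , Link.within l′ (there z′))
  XZ′YZ : Disjoint X (Z′ ++ Y ++ Z)
  XZ′YZ (x , r) with ∈-++⁻ Z′ r
  ... | inj₁ z′ = first∉ (Link.unique l′) z′ (Link.meetsˡ l′ (there z′) (Arc.within a (there x)))
  ... | inj₂ r′ with ∈-++⁻ Y r′
  ... | inj₁ y = disj (Arc.within a (there x) , Arc.within ra′ (there y))
  ... | inj₂ z = first∉ (Arc.unique a) x (Link.meetsʳ rl (there z) (Arc.within a (there x)))
  1≤Z : 1 ≤ length Z
  1≤Z = ∈⇒length>0 (end∈′ (Link.path rl) (λ { refl → disj (c∈ , b∈) }))
  1≤Z′ : 1 ≤ length Z′
  1≤Z′ = ∈⇒length>0 (end∈′ (Link.path l′) (λ { refl → disj (c′∈ , b′∈) }))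
  regroup : ∀ x y → x + y + 2 ≡ x + (1 + (y + 1))
  regroup = solve-∀
  enough : length X + length Y + 2 ≤ length (X ++ Z′ ++ Y ++ Z)
  enough rewrite length-++ X {Z′ ++ Y ++ Z} | length-++ Z′ {Y ++ Z} | length-++ Y {Z} | regroup (length X) (length Y) =
    +-monoʳ-≤ (length X) (+-mono-≤ 1≤Z′ (+-monoʳ-≤ (length Y) 1≤Z))

-- Every pair of links closes one cycle. Over the three pairs the arcs of `C` and of `B` sum to
-- twice the lengths of these cycles, and the 6 is two links in each of three cycles.
linked-cycles : ∀ {k v w C B} → DecidableEquality V → {R : V → V → Set} → Symmetric R → Circ R k →
                Walk R v C v → Unique C → Walk R w B w → Unique B → Disjoint C B →
                Linkage R (_∈ C) (_∈ B) 3 → 2 * length C + 2 * length B + 6 ≤ k + k + k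
linked-cycles {k = k} {C = C} {B} _≟_ {R} R-sym circ pC unC pB unB disj P =
  combine
    (three-arcs R-sym pC unC (c∈ i₀) (c∈ i₁) (c∈ i₂) (c≢ i₀ i₁ λ ()) (c≢ i₀ i₂ λ ()) (c≢ i₁ i₂ λ ()))
    (three-arcs R-sym pB unB (b∈ i₀) (b∈ i₁) (b∈ i₂) (b≢ i₀ i₁ λ ()) (b≢ i₀ i₂ λ ()) (b≢ i₁ i₂ λ ()))
  where
  i₀ i₁ i₂ : Fin 3
  i₀ = zero
  i₁ = suc zero
  i₂ = suc (suc zero)
  lk : ∀ i → ∃₂ λ c b → c ∈ C × b ∈ B × Link R C B (source P i ∷ trail P i) c b
  lk i = link _≟_ C B disj (walk P i) (source∈ P i) (target∈ P i)
  cᵢ bᵢ : Fin 3 → _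
  cᵢ i = proj₁ (lk i)
  bᵢ i = proj₁ (proj₂ (lk i))
  c∈ : ∀ i → cᵢ i ∈ C
  c∈ i = proj₁ (proj₂ (proj₂ (lk i)))
  b∈ : ∀ i → bᵢ i ∈ B
  b∈ i = proj₁ (proj₂ (proj₂ (proj₂ (lk i))))
  lᵢ : ∀ i → Link R C B (source P i ∷ trail P i) (cᵢ i) (bᵢ i)
  lᵢ i = proj₂ (proj₂ (proj₂ (proj₂ (lk i))))
  c≢ : ∀ i j → i ≢ j → cᵢ i ≢ cᵢ j
  c≢ i j i≢j eq = i≢j (disjoint P i j (Link.within (lᵢ i) (here refl)) (Link.within (lᵢ j) (here eq)))
  b≢ : ∀ i j → i ≢ j → bᵢ i ≢ bᵢ j
  b≢ i j i≢j eq = i≢j (disjoint P i j (Link.within (lᵢ i) (end∈ (Link.path (lᵢ i))))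
    (Link.within (lᵢ j) (subst (_∈ _) (sym eq) (end∈ (Link.path (lᵢ j))))))
  bound : ∀ i j → i ≢ j → ∀ {ℓ ℓ′} → Arc R C (cᵢ i) (cᵢ j) ℓ → Arc R B (bᵢ i) (bᵢ j) ℓ′ → ℓ + ℓ′ + 2 ≤ k
  bound i j i≢j = link-cycle R-sym circ disj (λ { (z∈ , z∈′) → i≢j (disjoint P i j z∈ z∈′) })
    (c∈ i) (c∈ j) (b∈ i) (b∈ j) (lᵢ i) (lᵢ j)
  regroup : ∀ p q r s t u → (p + s + 2) + (q + t + 2) + (r + u + 2) ≡ (p + q + r) + (s + t + u) + 6
  regroup = solve-∀
  combine : ThreeArcs R C (cᵢ i₀) (cᵢ i₁) (cᵢ i₂) → ThreeArcs R B (bᵢ i₀) (bᵢ i₁) (bᵢ i₂) →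
            2 * length C + 2 * length B + 6 ≤ k + k + k
  combine (p , q , r , a₁ , a₂ , a₃ , eqC) (s , t , u , b₁ , b₂ , b₃ , eqB) =
    subst (_≤ k + k + k) (trans (regroup p q r s t u) (cong₂ (λ m n → m + n + 6) eqC eqB))
      (+-mono-≤ (+-mono-≤ (bound i₀ i₁ (λ ()) a₁ b₁) (bound i₀ i₂ (λ ()) a₂ b₂)) (bound i₁ i₂ (λ ()) a₃ b₃))

-- Induced subgraphs and the virtual edge

Restrict : {V : Set} → (V → V → Set) → (V → Set) → V → V → Set
Restrict R A u v = R u v × A u × A v

Pair : {V : Set} → V → V → V → Set
Pair x y u = u ≡ x ⊎ u ≡ y

Join : {V : Set} → (V → V → Set) → V → V → V → V → Set
Join R x y u v = R u v ⊎ (u ≡ x × v ≡ y) ⊎ (u ≡ y × v ≡ x)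

restrict-sym : ∀ A → Symmetric R → Symmetric (Restrict R A)
restrict-sym A s (r , a , b) = s r , b , a

join-sym : Symmetric R → Symmetric (Join R x y)
join-sym s (inj₁ r)               = inj₁ (s r)
join-sym s (inj₂ (inj₁ (a , b))) = inj₂ (inj₂ (b , a))
join-sym s (inj₂ (inj₂ (a , b))) = inj₂ (inj₁ (b , a))

restrict? : {R : Fin N → Fin N → Set} {A : Fin N → Set} → Decidable₂ R → Decidable A → Decidable₂ (Restrict R A)
restrict? R? A? u v = R? u v ×-dec (A? u ×-dec A? v)

join? : {R : Fin N → Fin N → Set} → Decidable₂ R → ∀ x y → Decidable₂ (Join R x y)
join? R? x y u v = R? u v ⊎-dec ((u ≟ᶠ x) ×-dec (v ≟ᶠ y)) ⊎-dec ((u ≟ᶠ y) ×-dec (v ≟ᶠ x))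

walk-within : ∀ {A} → Walk (Restrict R A) u xs v → ∀ {z} → z ∈ xs → A z
walk-within ((_ , _ , a) ∷ p) (here refl) = a
walk-within (_ ∷ p)           (there m)   = walk-within p m

circ-⊆ : ∀ {k} → (∀ {u v} → R u v → R′ u v) → Circ R′ k → Circ R k
circ-⊆ f circ p = circ (map-walk f p)

circ-restrict : ∀ {k A} → Circ R k → Circ (Restrict R A) k
circ-restrict = circ-⊆ proj₁

first-new-edge : ∀ {zs} → Walk (Join R x y) u zs v → Walk R u zs v ⊎
  ∃₂ λ ps qs → ∃₂ λ s t → Walk R u ps s × Walk (Join R x y) t qs v × ((s ≡ x × t ≡ y) ⊎ (s ≡ y × t ≡ x)) × zs ≡ ps ++ t ∷ qs
first-new-edge []           = inj₁ []
first-new-edge (inj₂ e ∷ p) = inj₂ ([] , _ , _ , _ , [] , p , e , refl)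
first-new-edge (inj₁ r ∷ p) with first-new-edge p
... | inj₁ q = inj₁ (r ∷ q)
... | inj₂ (ps , qs , s , t , q₁ , q₂ , e , eq) = inj₂ (_ ∷ ps , qs , s , t , r ∷ q₁ , q₂ , e , cong (_ ∷_) eq)

closed-simple : Walk R u xs u → u ∉ xs → xs ≡ []
closed-simple []      _  = refl
closed-simple (r ∷ p) u∉ = ⊥-elim (u∉ (end∈ p))

-- A cycle through the new edge is rerouted through A₂.
circ-join : ∀ {k A₁ A₂ ws} → DecidableEquality V → {R : V → V → Set} → Symmetric R → Circ R k → 2 ≤ k → x ≢ y →
            A₁ x → A₁ y → (∀ {z} → A₁ z → A₂ z → Pair x y z) →
            Walk (Restrict R A₂) x ws y → Circ (Join (Restrict R A₁) x y) k
circ-join {x = x} {y} {k} {A₁} {A₂} _≟_ {R} R-sym circ 2≤k x≢y A₁x A₁y inter w = bound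
  where
  Ends : _ → _ → Set
  Ends s t = (s ≡ x × t ≡ y) ⊎ (s ≡ y × t ≡ x)
  detour : ∀ {s t} → Ends s t → ∃ λ ws → Walk (Restrict R A₂) s ws t × Unique (s ∷ ws)
  detour (inj₁ (refl , refl)) with ws , p , un , _ ← simplify _≟_ w = ws , p , un
  detour (inj₂ (refl , refl)) with ws′ , w′ , _ ← reverse-walk (restrict-sym A₂ R-sym) w
    with ws , p , un , _ ← simplify _≟_ w′ = ws , p , un
  ends≢ : ∀ {s t} → Ends s t → s ≢ t
  ends≢ (inj₁ (refl , refl)) = x≢y
  ends≢ (inj₂ (refl , refl)) = ≢-sym x≢y
  ends-A₁ : ∀ {s t} → Ends s t → A₁ t
  ends-A₁ (inj₁ (refl , refl)) = A₁y
  ends-A₁ (inj₂ (refl , refl)) = A₁x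
  ends-pair : ∀ {s t z} → Ends s t → Pair x y z → z ≡ s ⊎ z ≡ t
  ends-pair (inj₁ (refl , refl)) pr = pr
  ends-pair (inj₂ (refl , refl)) pr = swap pr
  ends-again : ∀ {s t s′ t′} → Ends s t → Ends s′ t′ → t′ ≢ t → s′ ≡ t × t′ ≡ s
  ends-again (inj₁ (refl , refl)) (inj₁ (refl , refl)) ne = ⊥-elim (ne refl)
  ends-again (inj₁ (refl , refl)) (inj₂ (refl , refl)) ne = refl , refl
  ends-again (inj₂ (refl , refl)) (inj₁ (refl , refl)) ne = refl , refl
  ends-again (inj₂ (refl , refl)) (inj₂ (refl , refl)) ne = ⊥-elim (ne refl)
  open-bound : ∀ {s t zs} → Ends s t → Walk (Join (Restrict R A₁) x y) t zs s → Unique (t ∷ zs) → length (t ∷ zs) ≤ k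
  open-bound {s} {t} {zs} e p un with first-new-edge p
  ... | inj₁ q with ws , d , un′ ← detour e =
    ≤-trans (≤-trans (≤-reflexive (+-comm 1 (length zs))) (+-monoʳ-≤ (length zs) (∈⇒length>0 (end∈′ d (ends≢ e)))))
      (ear-bound R-sym circ (arc (map-walk proj₁ q) un id refl) (map-walk proj₁ d) (unique-++ʳ (s ∷ []) un′) only)
    where
    inA₁ : ∀ {z} → z ∈ t ∷ zs → A₁ z
    inA₁ (here refl) = ends-A₁ e
    inA₁ (there m)   = walk-within q m
    only : ∀ {z} → z ∈ ws → z ∈ t ∷ zs → z ≡ t
    only z∈ws z∈ with ends-pair e (inter (inA₁ z∈) (walk-within d z∈ws))
    ... | inj₁ refl = ⊥-elim (Unique[x∷xs]⇒x∉xs un′ z∈ws)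
    ... | inj₂ z≡t  = z≡t
  -- A second use of the new edge must run the opposite way, as no vertex is entered twice. The
  -- closed walk then just goes back and forth and has length 2.
  ... | inj₂ (ps , qs , s′ , t′ , p₁ , p₂ , e′ , refl)
    with refl , refl ← ends-again e e′ (λ { refl → Unique[x∷xs]⇒x∉xs un (∈-++⁺ʳ ps (here refl)) })
    with refl ← closed-simple p₁ (λ t∈ → Unique[x∷xs]⇒x∉xs un (∈-++⁺ˡ t∈))
    with refl ← closed-simple p₂ (Unique[x∷xs]⇒x∉xs (unique-++ʳ (t ∷ []) un)) = 2≤k
  bound : Circ (Join (Restrict R A₁) x y) k
  bound p un with first-new-edge p
  ... | inj₁ q = circ-restrict circ q un
  ... | inj₂ (ps , qs , s , t , p₁ , p₂ , e , refl) =
    subst (_≤ k) (sym (↭-length (++-comm ps (t ∷ qs))))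
      (open-bound e (p₂ ⊙ map-walk inj₁ p₁) (Unique-resp-↭ (++-comm ps (t ∷ qs)) un))

-- Exhaustive search for long cycles

list? : ∀ ℓ {P : List (Fin N) → Set} → Decidable P → Dec (∃ λ xs → length xs ≡ ℓ × P xs)
list? zero P? = map′ (λ p → [] , refl , p) (λ { ([] , _ , p) → p }) (P? [])
list? (suc ℓ) P? = map′ (λ { (x , xs , eq , p) → x ∷ xs , cong suc eq , p })
                        (λ { (x ∷ xs , refl , p) → x , xs , refl , p })
                        (any? λ x → list? ℓ (P? ∘ (x ∷_)))

walk? : {R : Fin N → Fin N → Set} → Decidable₂ R → ∀ u v xs → Dec (Walk R u xs v)
walk? R? u v []       = map′ (λ { refl → [] }) (λ { [] → refl }) (u ≟ᶠ v)
walk? R? u v (w ∷ xs) = map′ (λ { (r , p) → r ∷ p }) (λ { (r ∷ p) → r , p }) (R? u w ×-dec walk? R? w v xs)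

-- The known bound makes the search finite: the lengths from `k` down to `suc j` are tried, and each
-- one without a cycle lowers the bound.
circ-or-cycle : {R : Fin N → Fin N → Set} → Decidable₂ R → ∀ k → Circ R k → ∀ j →
                Circ R j ⊎ ∃₂ λ v xs → Walk R v xs v × Unique xs × j < length xs
circ-or-cycle R? k circ j with k ≤? j
... | yes k≤j = inj₁ λ p un → ≤-trans (circ p un) k≤j
circ-or-cycle R? zero circ j | no k≰j = ⊥-elim (k≰j z≤n)
circ-or-cycle R? (suc k) circ j | no k≰j
  with any? (λ v → list? (suc k) (λ xs → walk? R? v v xs ×-dec unique? xs))
  where open import Data.List.Relation.Unary.Unique.DecPropositional _≟ᶠ_ using (unique?)
... | yes (v , xs , eq , p , un) = inj₂ (v , xs , p , un , subst (j <_) (sym eq) (≰⇒> k≰j))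
... | no  none = circ-or-cycle R? k (λ p un → ≤-pred (≤∧≢⇒< (circ p un) (λ eq → none (_ , _ , eq , p , un)))) j

-- Colourings

Mono : {V : Set} {c : ℕ} → (V → V → Set) → (V → Fin c) → V → V → Set
Mono R f u v = R u v × f u ≡ f v

BoundedAt : {V : Set} {c : ℕ} → (V → V → Set) → (V → Fin c) → ℕ → V → Set
BoundedAt R f k v = ∀ {us} → Unique us → (∀ {w} → w ∈ us → ∃ λ xs → Walk (Mono R f) v xs w) → length us ≤ k

bounded-transport : ∀ {c c′ k} {f : V → Fin c} {f′ : V → Fin c′} (P : V → Set) →
                    (∀ {u w} → P u → Mono R f u w → P w × Mono R′ f′ u w) →
                    P v → BoundedAt R′ f′ k v → BoundedAt R f k v
bounded-transport {R = R} {R′ = R′} {f = f} {f′} P advance Pv bounded un reach = bounded un (map₂ (go Pv) ∘ reach)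
  where
  go : ∀ {u w xs} → P u → Walk (Mono R f) u xs w → Walk (Mono R′ f′) u xs w
  go Pu []      = []
  go Pu (r ∷ p) with Pw , r′ ← advance Pu r = r′ ∷ go Pw p

walk-invariant : (P : V → Set) → (∀ {u w} → P u → R u w → P w) → P u → Walk R u xs v → P v
walk-invariant P advance Pu []      = Pu
walk-invariant P advance Pu (r ∷ p) = walk-invariant P advance (advance Pu r) p

bounded-inside : ∀ {c k} {f : V → Fin c} (P : V → Set) (I : List V) → (∀ {u w} → P u → Mono R f u w → P w) →
                 (∀ {u} → P u → u ∈ I) → length I ≤ k → P v → BoundedAt R f k v
bounded-inside P I advance inside I≤k Pv un reach =
  ≤-trans (unique-⊆-length un (λ w∈ → inside (walk-invariant P advance Pv (proj₂ (reach w∈))))) I≤k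

-- Only the values of `p` at `a` and `b` are prescribed. Taking a function on all vertices avoids a
-- consistency condition for `a ≡ b`, and lets the colouring of one side serve as the precolouring
-- of the other.
record Colouring {V : Set} (c k : ℕ) (R : V → V → Set) (a b : V) (p : V → Fin c) : Set where
  field
    colour   : V → Fin c
    fixedˡ   : colour a ≡ p a
    fixedʳ   : colour b ≡ p b
    isolated : ∀ {u w} → Pair a b u → Mono R colour u w → Pair a b w
    bounded  : ∀ v → BoundedAt R colour k v

open Colouring

Colourable : {V : Set} → ℕ → ℕ → (V → V → Set) → Set
Colourable c k R = ∀ a b p → a ≡ b ⊎ R a b → Colouring c k R a b p

-- Subgraphs keep the vertex type V, the deleted vertices becoming isolated; the induction is on the length of
-- a list U of vertices containing all the others.
Covers : {V : Set} → List V → (V → V → Set) → Set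
Covers U R = ∀ {u v} → R u v → u ∈ U

record Separation {V : Set} (R : V → V → Set) (U : List V) (x y : V) : Set₁ where
  field
    {A₁ A₂} : V → Set
    A₁?     : Decidable A₁
    A₂?     : Decidable A₂
    x∈₁     : A₁ x
    y∈₁     : A₁ y
    x∈₂     : A₂ x
    y∈₂     : A₂ y
    common  : ∀ {z} → A₁ z → A₂ z → Pair x y z
    edges   : ∀ {u v} → R u v → (A₁ u × A₁ v) ⊎ (A₂ u × A₂ v)
    covers  : ∀ v → A₁ v ⊎ A₂ v
    {z₁ z₂} : V
    z₁∈     : z₁ ∈ U
    z₂∈     : z₂ ∈ U
    z₁∉     : ¬ A₂ z₁
    z₂∉     : ¬ A₁ z₂

swap-separation : ∀ {U} → Separation R U x y → Separation R U x y
swap-separation s = record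
  { A₁? = A₂? ; A₂? = A₁? ; x∈₁ = x∈₂ ; y∈₁ = y∈₂ ; x∈₂ = x∈₁ ; y∈₂ = y∈₁
  ; common = λ a b → common b a ; edges = swap ∘ edges ; covers = swap ∘ covers
  ; z₁∈ = z₂∈ ; z₂∈ = z₁∈ ; z₁∉ = z₂∉ ; z₂∉ = z₁∉ }
  where open Separation s

pair? : (x y : Fin N) → Decidable (Pair x y)
pair? x y u = (u ≟ᶠ x) ⊎-dec (u ≟ᶠ y)

-- All separations are built in this way, from a set `D` that can be left only through `x` or `y`;
-- mostly `D` is a set of vertices reachable without passing through them.
separate : {R : Fin N → Fin N → Set} → Symmetric R → {U : List (Fin N)} {D : Fin N → Set} → Decidable D → ¬ D x → ¬ D y →
           (∀ {u v} → R u v → D u → ¬ D v → Pair x y v) →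
           z ∈ U → D z → w ∈ U → ¬ D w → ¬ Pair x y w → Separation R U x y
separate {x = x} {y} {R = R} R-sym {D = D} D? ¬Dx ¬Dy leave z∈ Dz w∈ ¬Dw ¬Pw = record
  { A₁? = λ v → D? v ⊎-dec pair? x y v ; A₂? = ¬? ∘ D?
  ; x∈₁ = inj₂ (inj₁ refl) ; y∈₁ = inj₂ (inj₂ refl) ; x∈₂ = ¬Dx ; y∈₂ = ¬Dy
  ; common = λ { (inj₁ Dv) ¬Dv → ⊥-elim (¬Dv Dv) ; (inj₂ Pv) _ → Pv }
  ; edges = edge ; covers = cover
  ; z₁∈ = z∈ ; z₂∈ = w∈ ; z₁∉ = λ ¬Dz → ¬Dz Dz
  ; z₂∉ = λ { (inj₁ Dw) → ¬Dw Dw ; (inj₂ Pw) → ¬Pw Pw } }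
  where
  edge : ∀ {u v} → R u v → ((D u ⊎ Pair x y u) × (D v ⊎ Pair x y v)) ⊎ (¬ D u × ¬ D v)
  edge {u} {v} r with D? u | D? v
  ... | yes Du | yes Dv = inj₁ (inj₁ Du , inj₁ Dv)
  ... | yes Du | no ¬Dv = inj₁ (inj₁ Du , inj₂ (leave r Du ¬Dv))
  ... | no ¬Du | yes Dv = inj₁ (inj₂ (leave (R-sym r) Dv ¬Du) , inj₁ Dv)
  ... | no ¬Du | no ¬Dv = inj₂ (¬Du , ¬Dv)
  cover : ∀ v → (D v ⊎ Pair x y v) ⊎ ¬ D v
  cover v with D? v
  ... | yes Dv = inj₁ (inj₁ Dv)
  ... | no ¬Dv = inj₂ ¬Dv

precoloured-side : ∀ {U a b} (s : Separation R U x y) → a ≡ b ⊎ R a b →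
                   (Separation.A₁ s a × Separation.A₁ s b) ⊎ (Separation.A₂ s a × Separation.A₂ s b)
precoloured-side s (inj₂ r) = Separation.edges s r
precoloured-side {a = a} s (inj₁ refl) with Separation.covers s a
... | inj₁ A₁a = inj₁ (A₁a , A₁a)
... | inj₂ A₂a = inj₂ (A₂a , A₂a)

-- Pasting colourings along a separation

module _ {R : V → V → Set} (R-sym : Symmetric R) {U : List V} {x y : V} (s : Separation R U x y) {c k : ℕ} where
  open Separation s

  -- Since `col₁` isolates `x` and `y`, no monochromatic edge leaves `A₂`, so each component is
  -- bounded by the colouring of one side. `R₁` may be larger than the induced subgraph, to allow
  -- for the virtual edge.
  glue : ∀ {R₁ a b p} → (∀ {u v} → Restrict R A₁ u v → R₁ u v) → A₂ a → A₂ b →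
         (col₂ : Colouring c k (Restrict R A₂) a b p) → Colouring c k R₁ x y (colour col₂) → Colouring c k R a b p
  glue {R₁} {a} {b} {p} sub A₂a A₂b col₂ col₁ = record
    { colour = f
    ; fixedˡ = trans (f-in A₂a) (fixedˡ col₂)
    ; fixedʳ = trans (f-in A₂b) (fixedʳ col₂)
    ; isolated = λ u∈ m → isolated col₂ u∈ (proj₂ (step₂ (pair-A₂ A₂a A₂b u∈) m))
    ; bounded = bnd
    }
    where
    f : V → Fin c
    f v = if does (A₂? v) then colour col₂ v else colour col₁ v
    f-in : ∀ {v} → A₂ v → f v ≡ colour col₂ v
    f-in {v} a rewrite dec-true (A₂? v) a = refl
    f-out : ∀ {v} → ¬ A₂ v → f v ≡ colour col₁ v
    f-out {v} a rewrite dec-false (A₂? v) a = refl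
    pair-A₂ : ∀ {a b u} → A₂ a → A₂ b → Pair a b u → A₂ u
    pair-A₂ A₂a A₂b (inj₁ refl) = A₂a
    pair-A₂ A₂a A₂b (inj₂ refl) = A₂b
    agree : ∀ {v} → Pair x y v → colour col₁ v ≡ colour col₂ v
    agree (inj₁ refl) = fixedˡ col₁
    agree (inj₂ refl) = fixedʳ col₁
    step₂ : ∀ {u w} → A₂ u → Mono R f u w → A₂ w × Mono (Restrict R A₂) (colour col₂) u w
    step₂ {u} {w} A₂u (r , eq) with A₂? w in dec
    ... | yes A₂w = A₂w , (r , A₂u , A₂w) , trans (sym (f-in A₂u)) eq
    ... | no ¬A₂w with edges r
    ... | inj₂ (_ , A₂w) = ⊥-elim (¬A₂w A₂w)
    ... | inj₁ (A₁u , A₁w) = ⊥-elim (¬A₂w (pair-A₂ x∈₂ y∈₂ (isolated col₁ u∈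
            (sub (r , A₁u , A₁w) , trans (agree u∈) (trans (sym (f-in A₂u)) eq)))))
      where u∈ = common A₁u A₂u
    step₁ : ∀ {u w} → ¬ A₂ u → Mono R f u w → ¬ A₂ w × Mono R₁ (colour col₁) u w
    step₁ {u} {w} ¬A₂u (r , eq) = ¬A₂w , sub (r , A₁uw (edges r)) , trans (sym (f-out ¬A₂u)) (trans eq (f-out ¬A₂w))
      where
      ¬A₂w : ¬ A₂ w
      ¬A₂w A₂w = ¬A₂u (proj₁ (step₂ A₂w (R-sym r , sym eq)))
      A₁uw : (A₁ u × A₁ w) ⊎ (A₂ u × A₂ w) → A₁ u × A₁ w
      A₁uw (inj₁ a)       = a
      A₁uw (inj₂ (a , _)) = ⊥-elim (¬A₂u a)
    bnd : ∀ v → BoundedAt R f k v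
    bnd v with A₂? v
    ... | yes A₂v = bounded-transport A₂ step₂ A₂v (bounded col₂ v)
    ... | no ¬A₂v = bounded-transport (¬_ ∘ A₂) step₁ ¬A₂v (bounded col₁ v)

covers-filter : ∀ {U A} (A? : Decidable A) → Covers U R → Covers (filter A? U) (Restrict R A)
covers-filter A? cov (r , a , _) = ∈-filter⁺ A? (cov r) a

filter-shorter : ∀ {U} {A : V → Set} (A? : Decidable A) → z ∈ U → ¬ A z → length (filter A? U) < length U
filter-shorter A? z∈ ¬Az = filter-notAll A? _ (lose z∈ ¬Az)

Below : (N c k m : ℕ) → Set₁
Below N c k m = (R : Fin N → Fin N → Set) → Decidable₂ R → Symmetric R → Circ R k →
                ∀ U → Covers U R → length U < m → Colourable c k R

module _ {R : Fin N → Fin N → Set} (R? : Decidable₂ R) (R-sym : Symmetric R) {c k : ℕ} (circ : Circ R k)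
         {U : List (Fin N)} (cov : Covers U R) (below : Below N c k (length U)) where

  side : {A : Fin N → Set} → Decidable A → z ∈ U → ¬ A z → Colourable c k (Restrict R A)
  side {A = A} A? z∈ ¬Az =
    below _ (restrict? R? A?) (restrict-sym A R-sym) (circ-restrict {A = A} circ) _ (covers-filter {R = R} A? cov) (filter-shorter A? z∈ ¬Az)

  restrict-pair : ∀ {A : Fin N → Set} {a b} → A a → A b → a ≡ b ⊎ R a b → a ≡ b ⊎ Restrict R A a b
  restrict-pair _  _  (inj₁ e) = inj₁ e
  restrict-pair Aa Ab (inj₂ r) = inj₂ (r , Aa , Ab)

  colour-separation₁ : Separation R U x x → Colourable c k R
  colour-separation₁ {x} s a b p adj with precoloured-side s adj
  ... | inj₂ (A₂a , A₂b) = glue R-sym s id A₂a A₂b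
          (side A₂? z₁∈ z₁∉ a b p (restrict-pair A₂a A₂b adj)) (side A₁? z₂∈ z₂∉ x x _ (inj₁ refl))
    where open Separation s
  ... | inj₁ (A₁a , A₁b) = glue R-sym (swap-separation s) id A₁a A₁b
          (side A₁? z₂∈ z₂∉ a b p (restrict-pair A₁a A₁b adj)) (side A₂? z₁∈ z₁∉ x x _ (inj₁ refl))
    where open Separation s

  -- With X the component of x in A₂, only x leads out of X and only y leads out of A₂ ∖ X.
  cut-vertex : (s : Separation R U x y) → ¬ (∃₂ λ u xs → u ≡ x × Walk (Restrict R (Separation.A₂ s)) u xs y) →
               ∃ λ z → Separation R U z z
  cut-vertex {x} {y} s no-walk = by-component (X? z₂)
    where
    open Separation s
    X : Fin N → Set
    X v = ∃₂ λ u xs → u ≡ x × Walk (Restrict R A₂) u xs v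
    X? : Decidable X
    X? = reach? (restrict? R? A₂?) (_≟ᶠ x)
    Xx : X x
    Xx = x , [] , refl , []
    X⊆A₂ : ∀ {v} → X v → A₂ v
    X⊆A₂ (_ , [] , refl , [])        = x∈₂
    X⊆A₂ (_ , _ ∷ _ , _ , p@(_ ∷ _)) = walk-within p (end∈ᶜ p)
    X-step : ∀ {u v} → X u → Restrict R A₂ u v → X v
    X-step (_ , _ , e , p) r = _ , _ , e , (p ⊙ (r ∷ []))
    leave-X : ∀ {u v} → R u v → X u × u ≢ x → ¬ (X v × v ≢ x) → Pair x x v
    leave-X {v = v} r (Xu , u≢x) ¬Dv with v ≟ᶠ x | edges r
    ... | yes v≡x | _            = inj₁ v≡x
    ... | no  v≢x | inj₂ (a , b) = ⊥-elim (¬Dv (X-step Xu (r , a , b) , v≢x))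
    ... | no  v≢x | inj₁ (a , _) with common a (X⊆A₂ Xu)
    ... | inj₁ u≡x  = ⊥-elim (u≢x u≡x)
    ... | inj₂ refl = ⊥-elim (no-walk Xu)
    leave-rest : ∀ {u v} → R u v → A₂ u × ¬ X u × u ≢ y → ¬ (A₂ v × ¬ X v × v ≢ y) → Pair y y v
    leave-rest {v = v} r (A₂u , ¬Xu , u≢y) ¬Dv with v ≟ᶠ y | edges r
    ... | yes v≡y | _            = inj₁ v≡y
    ... | no  v≢y | inj₂ (a , b) = ⊥-elim (¬Dv (b , (λ Xv → ¬Xu (X-step Xv (R-sym r , b , a))) , v≢y))
    ... | no  v≢y | inj₁ (a , _) with common a A₂u
    ... | inj₁ refl = ⊥-elim (¬Xu Xx)
    ... | inj₂ u≡y  = ⊥-elim (u≢y u≡y)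
    by-component : Dec (X z₂) → ∃ λ z → Separation R U z z
    by-component (yes Xz₂) = x , separate R-sym (λ v → X? v ×-dec ¬? (v ≟ᶠ x))
      (λ D → proj₂ D refl) (λ D → proj₂ D refl) leave-X
      z₂∈ (Xz₂ , λ { refl → z₂∉ x∈₁ }) z₁∈ (z₁∉ ∘ X⊆A₂ ∘ proj₁)
      λ { (inj₁ refl) → z₁∉ x∈₂ ; (inj₂ refl) → z₁∉ x∈₂ }
    by-component (no ¬Xz₂) = y , separate R-sym (λ v → A₂? v ×-dec ¬? (X? v) ×-dec ¬? (v ≟ᶠ y))
      (λ D → proj₂ (proj₂ D) refl) (λ D → proj₂ (proj₂ D) refl) leave-rest
      z₂∈ (A₂z₂ (covers z₂) , ¬Xz₂ , λ { refl → z₂∉ y∈₁ }) z₁∈ (z₁∉ ∘ proj₁)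
      λ { (inj₁ refl) → z₁∉ y∈₂ ; (inj₂ refl) → z₁∉ y∈₂ }
      where
      A₂z₂ : A₁ z₂ ⊎ A₂ z₂ → A₂ z₂
      A₂z₂ (inj₁ a) = ⊥-elim (z₂∉ a)
      A₂z₂ (inj₂ a) = a

  -- The virtual edge makes `x , y` an admissible precoloured pair for the other side. It is
  -- harmless if `A₂` contains a path from `x` to `y`; if there is none, one of the two vertices
  -- separates alone.
  colour-separation₂′ : 2 ≤ k → x ≢ y → (s : Separation R U x y) → ∀ {a b} p → a ≡ b ⊎ R a b →
                        Separation.A₂ s a → Separation.A₂ s b → Colouring c k R a b p
  colour-separation₂′ {x} {y} 2≤k x≢y s p adj A₂a A₂b
    with reach? (restrict? R? (Separation.A₂? s)) (_≟ᶠ x) y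
  ... | no no-walk = colour-separation₁ (proj₂ (cut-vertex s no-walk)) _ _ p adj
  ... | yes (_ , ws , refl , w) = glue R-sym s inj₁ A₂a A₂b
      (side A₂? z₁∈ z₁∉ _ _ p (restrict-pair A₂a A₂b adj))
      (below _ (join? (restrict? R? A₁?) x y) (join-sym (restrict-sym A₁ R-sym))
        (circ-join _≟ᶠ_ R-sym circ 2≤k x≢y x∈₁ y∈₁ common w) (filter A₁? U) cov′ (filter-shorter A₁? z₂∈ z₂∉)
        x y _ (inj₂ (inj₂ (inj₁ (refl , refl)))))
    where
    open Separation s
    starts : ∀ {x y ws} → x ≢ y → Walk (Restrict R A₂) x ws y → x ∈ U
    starts x≢y []            = ⊥-elim (x≢y refl)
    starts x≢y ((r , _) ∷ _) = cov r
    x∈U : x ∈ U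
    x∈U = starts x≢y w
    y∈U : y ∈ U
    y∈U = starts (≢-sym x≢y) (proj₁ (proj₂ (reverse-walk (restrict-sym A₂ R-sym) w)))
    cov′ : Covers (filter A₁? U) (Join (Restrict R A₁) x y)
    cov′ (inj₁ r)                     = covers-filter {R = R} A₁? cov r
    cov′ (inj₂ (inj₁ (refl , refl))) = ∈-filter⁺ A₁? x∈U x∈₁
    cov′ (inj₂ (inj₂ (refl , refl))) = ∈-filter⁺ A₁? y∈U y∈₁

  colour-separation : 2 ≤ k → Separation R U x y → Colourable c k R
  colour-separation {x} {y} 2≤k s with x ≟ᶠ y
  ... | yes refl = colour-separation₁ s
  ... | no x≢y = λ a b p adj → by-side p adj (precoloured-side s adj)
    where
    by-side : ∀ {a b} p → a ≡ b ⊎ R a b → _ → Colouring c k R a b p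
    by-side p adj (inj₂ (A₂a , A₂b)) = colour-separation₂′ 2≤k x≢y s p adj A₂a A₂b
    by-side p adj (inj₁ (A₁a , A₁b)) = colour-separation₂′ 2≤k x≢y (swap-separation s) p adj A₁a A₁b

-- Spending three colours on the pair and a cycle

spare-colours : ∀ {m} (α β : Fin (3 + m)) → ∃₂ λ γ (e : Fin m → Fin (3 + m)) →
                γ ≢ α × γ ≢ β × (∀ {i j} → e i ≡ e j → i ≡ j) × (∀ i → e i ≢ α × e i ≢ β × e i ≢ γ)
spare-colours {m} α β = g zero , g ∘ suc , g≢α zero , g≢β zero , (λ eq → suc-inj (g-inj eq)) ,
  λ i → g≢α (suc i) , g≢β (suc i) , λ eq → 0≢suc (g-inj (sym eq))
  where
  avoid : ∃ λ β′ → ∀ j → punchIn α (punchIn β′ j) ≢ β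
  avoid with α ≟ᶠ β
  -- For equal `α` and `β` a second, arbitrary colour is dropped as well, to keep the count uniform.
  ... | yes refl = zero , λ j → punchInᵢ≢i α _
  ... | no  α≢β  = punchOut α≢β , λ j eq → punchInᵢ≢i (punchOut α≢β) j
                     (punchIn-injective α _ _ (trans eq (sym (punchIn-punchOut α≢β))))
  g : Fin (suc m) → Fin (3 + m)
  g j = punchIn α (punchIn (proj₁ avoid) j)
  g≢α : ∀ j → g j ≢ α
  g≢α j = punchInᵢ≢i α _
  g≢β : ∀ j → g j ≢ β
  g≢β = proj₂ avoid
  g-inj : ∀ {i j} → g i ≡ g j → i ≡ j
  g-inj eq = punchIn-injective (proj₁ avoid) _ _ (punchIn-injective α _ _ eq)
  suc-inj : ∀ {n} {i j : Fin n} → Fin.suc i ≡ suc j → i ≡ j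
  suc-inj refl = refl
  0≢suc : ∀ {n} {i : Fin n} → Fin.zero ≢ suc i
  0≢suc ()

∃-outside : (xs ys : List (Fin N)) → Unique xs → length ys < length xs → ∃ λ z → z ∈ xs × z ∉ ys
∃-outside xs ys un ys<xs with all? (_∈? ys) xs
  where open import Data.List.Membership.DecPropositional _≟ᶠ_ using (_∈?_)
... | yes inside = ⊥-elim (<⇒≱ ys<xs (unique-⊆-length un (All.lookup inside)))
... | no  ¬inside = find (¬All⇒Any¬ (_∈? ys) xs ¬inside)
  where open import Data.List.Membership.DecPropositional _≟ᶠ_ using (_∈?_)

module _ {R : Fin N → Fin N → Set} (R-sym : Symmetric R) {c k : ℕ} where
  open import Data.List.Membership.DecPropositional (_≟ᶠ_ {N}) using (_∈?_)

  -- No monochromatic edge joins two of the layers: the pair, the other vertices of `C`, and the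
  -- rest. The pair may be monochromatic, hence `2 ≤ k`. Freshness concerns only vertices with an
  -- edge, so it is vacuous when `C` covers all of these.
  colour-layer : ∀ {a b γ} (p : Fin N → Fin c) (C : List (Fin N)) (h : Fin N → Fin c) → 2 ≤ k → length C ≤ k → γ ≢ p a → γ ≢ p b →
          (∀ {u w} → R u w → u ∉ C → ¬ Pair a b u → h u ≢ p a × h u ≢ p b × h u ≢ γ) →
          (∀ v → BoundedAt (Restrict R (λ u → u ∉ C × ¬ Pair a b u)) h k v) → Colouring c k R a b p
  colour-layer {a} {b} {γ} p C h 2≤k C≤k γ≢pa γ≢pb fresh bnd = record
    { colour = f ; fixedˡ = f-pair (inj₁ refl) ; fixedʳ = f-pair (inj₂ refl) ; isolated = isol ; bounded = bound }
    where
    locate : ∀ v → Pair a b v ⊎ (¬ Pair a b v × v ∈ C) ⊎ (¬ Pair a b v × v ∉ C)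
    locate v with pair? a b v | v ∈? C
    ... | yes v∈ | _       = inj₁ v∈
    ... | no  v∉ | yes v∈C = inj₂ (inj₁ (v∉ , v∈C))
    ... | no  v∉ | no  v∉C = inj₂ (inj₂ (v∉ , v∉C))
    f : Fin N → Fin c
    f v = if does (pair? a b v) then p v else if does (v ∈? C) then γ else h v
    f-pair : ∀ {v} → Pair a b v → f v ≡ p v
    f-pair {v} v∈ rewrite dec-true (pair? a b v) v∈ = refl
    f-C : ∀ {v} → ¬ Pair a b v → v ∈ C → f v ≡ γ
    f-C {v} v∉ v∈ rewrite dec-false (pair? a b v) v∉ | dec-true (v ∈? C) v∈ = refl
    f-rest : ∀ {v} → ¬ Pair a b v → v ∉ C → f v ≡ h v
    f-rest {v} v∉ v∉C rewrite dec-false (pair? a b v) v∉ | dec-false (v ∈? C) v∉C = refl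
    avoids : ∀ {u x} → Pair a b u → x ≢ p a → x ≢ p b → x ≢ p u
    avoids (inj₁ refl) x≢pa _ = x≢pa
    avoids (inj₂ refl) _ x≢pb = x≢pb
    isol : ∀ {u w} → Pair a b u → Mono R f u w → Pair a b w
    isol {u} {w} u∈ (r , eq) with locate w
    ... | inj₁ w∈ = w∈
    ... | inj₂ (inj₁ (w∉ , w∈C)) = ⊥-elim (avoids u∈ γ≢pa γ≢pb (trans (sym (f-C w∉ w∈C)) (trans (sym eq) (f-pair u∈))))
    ... | inj₂ (inj₂ (w∉ , w∉C)) with h≢pa , h≢pb , _ ← fresh (R-sym r) w∉C w∉ =
      ⊥-elim (avoids u∈ h≢pa h≢pb (trans (sym (f-rest w∉ w∉C)) (trans (sym eq) (f-pair u∈))))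
    isol′ : ∀ {u w} → ¬ Pair a b u → Mono R f u w → ¬ Pair a b w
    isol′ u∉ (r , eq) w∈ = u∉ (isol w∈ (R-sym r , sym eq))
    stepC : ∀ {u w} → ¬ Pair a b u × u ∈ C → Mono R f u w → ¬ Pair a b w × w ∈ C
    stepC {u} {w} (u∉ , u∈C) m@(r , eq) with locate w
    ... | inj₁ w∈                = ⊥-elim (isol′ u∉ m w∈)
    ... | inj₂ (inj₁ (w∉ , w∈C)) = w∉ , w∈C
    ... | inj₂ (inj₂ (w∉ , w∉C)) = ⊥-elim (proj₂ (proj₂ (fresh (R-sym r) w∉C w∉))
                      (trans (sym (f-rest w∉ w∉C)) (trans (sym eq) (f-C u∉ u∈C))))
    advance : ∀ {u w} → u ∉ C × ¬ Pair a b u → Mono R f u w →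
           (w ∉ C × ¬ Pair a b w) × Mono (Restrict R (λ u → u ∉ C × ¬ Pair a b u)) h u w
    advance {u} {w} (u∉C , u∉) m@(r , eq) =
      (w∉C , w∉) , (r , (u∉C , u∉) , (w∉C , w∉)) , trans (sym (f-rest u∉ u∉C)) (trans eq (f-rest w∉ w∉C))
      where
      w∉ = isol′ u∉ m
      w∉C : w ∉ C
      w∉C w∈C = u∉C (proj₂ (stepC (w∉ , w∈C) (R-sym r , sym eq)))
    pair-list : ∀ {u} → Pair a b u → u ∈ a ∷ b ∷ []
    pair-list (inj₁ refl) = here refl
    pair-list (inj₂ refl) = there (here refl)
    bound : ∀ v → BoundedAt R f k v
    bound v with locate v
    ... | inj₁ v∈                = bounded-inside (Pair a b) (a ∷ b ∷ []) isol pair-list 2≤k v∈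
    ... | inj₂ (inj₁ (v∉ , v∈C)) = bounded-inside (λ u → ¬ Pair a b u × u ∈ C) C stepC proj₂ C≤k (v∉ , v∈C)
    ... | inj₂ (inj₂ (v∉ , v∉C)) = bounded-transport (λ u → u ∉ C × ¬ Pair a b u) advance (v∉C , v∉) (bnd v)

bounded-edgeless : ∀ {c k} {f : V → Fin c} → 1 ≤ k → (∀ {u w} → R u w → u ≡ w) → BoundedAt R f k v
bounded-edgeless {v = v} 1≤k loops = bounded-inside (_≡ v) (v ∷ []) (λ { refl (r , _) → sym (loops r) }) here 1≤k refl

colouring-mono : ∀ {V : Set} {c k k′ R a b p} → k ≤ k′ → Colouring {V} c k R a b p → Colouring c k′ R a b p
colouring-mono k≤k′ col = record
  { colour = colour col ; fixedˡ = fixedˡ col ; fixedʳ = fixedʳ col ; isolated = isolated col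
  ; bounded = λ v un reach → ≤-trans (bounded col v un reach) k≤k′ }

circ-1-loops : {R : Fin N → Fin N → Set} → Symmetric R → Circ R 1 → R u v → u ≡ v
circ-1-loops {u = u} {v} R-sym circ r with u ≟ᶠ v
... | yes eq = eq
... | no  ne with s≤s () ← circ (r ∷ R-sym r ∷ []) (∉-unique (λ { (here e) → ne (sym e) }) ([] ∷ []))

cycle-covered : ∀ {U C} → Symmetric R → Covers U R → Walk R v C v → C ⊆ U
cycle-covered R-sym cov p z∈ with _ , r ← step-into p z∈ = cov (R-sym r)

-- Separations obtained from cycles

module _ {R : Fin N → Fin N → Set} (R? : Decidable₂ R) (R-sym : Symmetric R) {U : List (Fin N)} where
  open import Data.List.Membership.DecPropositional (_≟ᶠ_ {N}) using (_∈?_)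

  -- A component attached at two vertices of a cycle of length k ≤ 3 would lengthen one of the two arcs between them.
  small-separation : ∀ {k C} → Covers U R → Circ R k → Walk R v C v → Unique C → length C ≡ k → 2 ≤ k → k ≤ 3 → u ∈ U → u ∉ C →
                     ∃ λ x → Separation R U x x
  small-separation {v} {u} {k} {C} cov circ p un C≡k 2≤k k≤3 u∈ u∉ =
    by-attachment (any? λ c → any? λ d → (c ∈? C) ×-dec D? d ×-dec R? d c)
    where
    Rest = Restrict R (_∉ C)
    D : Fin N → Set
    D w = ∃₂ λ s xs → s ≡ u × Walk Rest s xs w
    D? : Decidable D
    D? = reach? (restrict? R? (λ w → ¬? (w ∈? C))) (_≟ᶠ u)
    D⊆ : ∀ {w} → D w → w ∉ C
    D⊆ (_ , [] , refl , [])         = u∉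
    D⊆ (_ , _ ∷ _ , _ , q@(_ ∷ _)) = walk-within q (end∈ᶜ q)
    D-step : ∀ {w z} → R w z → D w → ¬ D z → z ∈ C
    D-step {w} {z} r Dw@(_ , _ , e , q) ¬Dz with z ∈? C
    ... | yes z∈ = z∈
    ... | no  z∉ = ⊥-elim (¬Dz (_ , _ , e , (q ⊙ ((r , D⊆ Dw , z∉) ∷ []))))
    2≤C : 2 ≤ length C
    2≤C = subst (2 ≤_) (sym C≡k) 2≤k
    at : ∀ {x} → x ∈ C → (∀ {w z} → R w z → D w → z ∈ C → z ≡ x) → Separation R U x x
    at {x} x∈ only with c , c∈ , c∉ ← ∃-outside C (x ∷ []) un 2≤C =
      separate R-sym D? (λ Dx → D⊆ Dx x∈) (λ Dx → D⊆ Dx x∈)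
        (λ r Dw ¬Dz → inj₁ (only r Dw (D-step r Dw ¬Dz)))
        u∈ (_ , _ , refl , []) (cycle-covered R-sym cov p c∈) (λ Dc → D⊆ Dc c∈)
        λ { (inj₁ e) → c∉ (here e) ; (inj₂ e) → c∉ (here e) }
    ear : ∀ {c d w z} → c ∈ C → D d → R d c → R w z → D w → z ∈ C → z ≢ c → ⊥
    ear {c} {d} {w} {z} c∈ Dd@(_ , _ , refl , q) rdc rwz Dw@(_ , _ , refl , q′) z∈ z≢c
      with ys , r , _ ← reverse-walk (restrict-sym (_∉ C) R-sym) q′
      with ws , s , uniq , _ ← simplify _≟ᶠ_ (r ⊙ q)
      with ℓ , ℓ′ , arc₁ , arc₂ , eq ← two-arcs R-sym p un c∈ z∈ (≢-sym z≢c) =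
      -- The ear passes outside `C` and so has at least two edges. With either arc it closes a
      -- cycle; the two bounds sum to k + 4 ≤ 2k.
      <⇒≱ (s≤s k≤3) (+-cancelˡ-≤ k 4 k (begin
        k + 4                           ≡⟨ cong (_+ 4) (trans (sym C≡k) (sym eq)) ⟩
        ℓ + ℓ′ + 4                      ≡⟨ regroup ℓ ℓ′ ⟩
        (ℓ + 2) + (ℓ′ + 2)              ≤⟨ +-mono-≤ (bound arc₁) (bound arc₂) ⟩
        k + k                           ∎))
      where
      open ≤-Reasoning
      regroup : ∀ a b → a + b + 4 ≡ (a + 2) + (b + 2)
      regroup = solve-∀
      trail∉ : ∀ {t} → t ∈ w ∷ ws → t ∉ C
      trail∉ (here refl) = D⊆ Dw
      trail∉ (there t∈)  = walk-within s t∈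
      only : ∀ {t} → t ∈ w ∷ ws ++ c ∷ [] → t ∈ C → t ≡ c
      only t∈ t∈C with ∈-++⁻ (w ∷ ws) t∈
      ... | inj₁ t∈ws     = ⊥-elim (trail∉ t∈ws t∈C)
      ... | inj₂ (here e) = e
      bound : ∀ {ℓ} → Arc R C c z ℓ → ℓ + 2 ≤ k
      bound {ℓ} a = ≤-trans (+-monoʳ-≤ ℓ (s≤s (subst (1 ≤_) (sym (trans (length-++ ws) (+-comm (length ws) 1))) (s≤s z≤n))))
        (ear-bound R-sym circ a (R-sym rwz ∷ (map-walk proj₁ s ⊙ (rdc ∷ [])))
          (Uniqueₚ.++⁺ uniq ([] ∷ []) λ { (t∈ , here refl) → trail∉ t∈ c∈ }) only)
    by-attachment : Dec (∃₂ λ c d → c ∈ C × D d × R d c) → ∃ λ x → Separation R U x x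
    -- Here the empty set already separates the component from `C`, and any vertex of `C` may serve
    -- as `x`.
    by-attachment (no none) with c , c∈ , _ ← ∃-outside C [] un (<⇒≤ 2≤C) =
      c , at c∈ λ r Dw z∈ → ⊥-elim (none (_ , _ , z∈ , Dw , r))
    by-attachment (yes (c , d , c∈ , Dd , rdc)) = c , at c∈ only
      where
      only : ∀ {w z} → R w z → D w → z ∈ C → z ≡ c
      only {w} {z} r Dw z∈ with z ≟ᶠ c
      ... | yes e = e
      ... | no ne = ⊥-elim (ear c∈ Dd rdc r Dw z∈ ne)

  -- A cycle with at least three vertices has one outside `{x , y}`. Such vertices of `C` and `B`
  -- lie strictly on opposite sides, as any walk between them meets `S`.
  separator-separation : ∀ {C B S} → Unique C → Unique B → 3 ≤ length C → 3 ≤ length B → C ⊆ U → B ⊆ U →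
                         Separates R (_∈ C) (_∈ B) S → (∀ {z} → z ∈ S → Pair x y z) → Separation R U x y
  separator-separation {x} {y} {C} {B} {S} unC unB 3≤C 3≤B C⊆U B⊆U sep S⊆
    with z , z∈ , z∉ ← ∃-outside C (x ∷ y ∷ []) unC 3≤C | w , w∈ , w∉ ← ∃-outside B (x ∷ y ∷ []) unB 3≤B =
    separate R-sym D? (λ Dx → D⊆ Dx (inj₁ refl)) (λ Dy → D⊆ Dy (inj₂ refl)) leave
      (C⊆U z∈) (_ , _ , (z∈ , ¬pair z∉) , []) (B⊆U w∈) (λ Dw → D∩B Dw w∈) (¬pair w∉)
    where
    Rest = Restrict R (λ v → ¬ Pair x y v)
    D : Fin N → Set
    D v = ∃₂ λ u xs → (u ∈ C × ¬ Pair x y u) × Walk Rest u xs v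
    D? : Decidable D
    D? = reach? (restrict? R? (¬? ∘ pair? x y)) (λ u → (u ∈? C) ×-dec ¬? (pair? x y u))
    ¬pair : ∀ {z} → z ∉ x ∷ y ∷ [] → ¬ Pair x y z
    ¬pair z∉ (inj₁ e) = z∉ (here e)
    ¬pair z∉ (inj₂ e) = z∉ (there (here e))
    stays-out : ∀ {u v xs} → ¬ Pair x y u → Walk Rest u xs v → ∀ {z} → z ∈ u ∷ xs → ¬ Pair x y z
    stays-out ¬Pu p (here refl) = ¬Pu
    stays-out ¬Pu p (there z∈)  = walk-within p z∈
    D⊆ : ∀ {v} → D v → ¬ Pair x y v
    D⊆ (_ , _ , (_ , ¬Pu) , p) = stays-out ¬Pu p (end∈ p)
    D∩B : ∀ {v} → D v → v ∉ B
    D∩B (_ , _ , (u∈ , ¬Pu) , p) v∈ with t , t∈ , t∈S ← find (sep u∈ v∈ (map-walk proj₁ p)) = stays-out ¬Pu p t∈ (S⊆ t∈S)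
    leave : ∀ {u v} → R u v → D u → ¬ D v → Pair x y v
    leave {v = v} r Du@(_ , _ , a , p) ¬Dv with pair? x y v
    ... | yes Pv = Pv
    ... | no ¬Pv = ⊥-elim (¬Dv (_ , _ , a , (p ⊙ ((r , D⊆ Du , ¬Pv) ∷ []))))

  small-separator-separation : ∀ {C B S} → Unique C → Unique B → 3 ≤ length C → 3 ≤ length B → C ⊆ U → B ⊆ U →
                               Separates R (_∈ C) (_∈ B) S → length S < 3 → ∃₂ λ x y → Separation R U x y
  small-separator-separation {S = []} unC unB 3≤C 3≤B C⊆U B⊆U sep _ with z , _ ← ∃-outside _ [] unC (<-≤-trans (s≤s z≤n) 3≤C) =
    z , z , separator-separation unC unB 3≤C 3≤B C⊆U B⊆U sep λ ()
  small-separator-separation {S = x ∷ []} unC unB 3≤C 3≤B C⊆U B⊆U sep _ =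
    x , x , separator-separation unC unB 3≤C 3≤B C⊆U B⊆U sep λ { (here e) → inj₁ e }
  small-separator-separation {S = x ∷ y ∷ []} unC unB 3≤C 3≤B C⊆U B⊆U sep _ =
    x , y , separator-separation unC unB 3≤C 3≤B C⊆U B⊆U sep λ { (here e) → inj₁ e ; (there (here e)) → inj₂ e }
  small-separator-separation {S = _ ∷ _ ∷ _ ∷ _} _ _ _ _ _ _ _ (s≤s (s≤s (s≤s ())))

-- Halving the circumference and the main induction

n≤2⌊n/2⌋+1 : ∀ n → n ≤ ⌊ n /2⌋ + ⌊ n /2⌋ + 1
n≤2⌊n/2⌋+1 0             = z≤n
n≤2⌊n/2⌋+1 1             = s≤s z≤n
n≤2⌊n/2⌋+1 (suc (suc n)) = ≤-trans (s≤s (s≤s (n≤2⌊n/2⌋+1 n))) (≤-reflexive (shift ⌊ n /2⌋))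
  where
  shift : ∀ h → 2 + (h + h + 1) ≡ (1 + h) + (1 + h) + 1
  shift = solve-∀

2⌊n/2⌋≤n : ∀ n → 2 * ⌊ n /2⌋ ≤ n
2⌊n/2⌋≤n 0             = z≤n
2⌊n/2⌋≤n 1             = z≤n
2⌊n/2⌋≤n (suc (suc n)) = ≤-trans (≤-reflexive (shift ⌊ n /2⌋)) (s≤s (s≤s (2⌊n/2⌋≤n n)))
  where
  shift : ∀ h → 2 * (1 + h) ≡ 2 + 2 * h
  shift = solve-∀

-- An integer above ⌊k/2⌋ has a double greater than `k`, so the left side exceeds 3k.
long-cycles-unlinked : ∀ k B → ⌊ k /2⌋ < B → ¬ (2 * k + 2 * B + 6 ≤ k + k + k)
long-cycles-unlinked k B h<B le = 1+n≰n {k + k + k} (begin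
  1 + (k + k + k)                          ≤⟨ s≤s (+-monoʳ-≤ (k + k) (n≤2⌊n/2⌋+1 k)) ⟩
  1 + (k + k + (⌊ k /2⌋ + ⌊ k /2⌋ + 1))    ≡⟨ regroup k ⌊ k /2⌋ ⟩
  2 * k + (suc ⌊ k /2⌋ + suc ⌊ k /2⌋)      ≤⟨ +-monoʳ-≤ (2 * k) (+-mono-≤ h<B h<B) ⟩
  2 * k + (B + B)                          ≤⟨ +-monoʳ-≤ (2 * k) (m≤m+n (B + B) 6) ⟩
  2 * k + (B + B + 6)                      ≡⟨ regroup′ k B ⟩
  2 * k + 2 * B + 6                        ≤⟨ le ⟩
  k + k + k                                ∎)
  where
  open ≤-Reasoning
  regroup : ∀ k h → 1 + (k + k + (h + h + 1)) ≡ 2 * k + ((1 + h) + (1 + h))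
  regroup = solve-∀
  regroup′ : ∀ k b → 2 * k + (b + b + 6) ≡ 2 * k + 2 * b + 6
  regroup′ = solve-∀

-- The recursion is lexicographic in `L` and the fuel `s`, which exceeds `k` plus the length of `U`.
-- A separation shortens `U`, the absence of a cycle of length `k` lowers `k`, and halving lowers
-- `L`, after which the fuel is renewed. Only the upper bound on `k` is kept, since `k` may decrease
-- while `L` stays.
coloured : ∀ L s {k} → 1 ≤ k → k < 2 ^ (2 + L) → (R : Fin N → Fin N → Set) → Decidable₂ R → Symmetric R → Circ R k →
           ∀ U → Covers U R → k + length U < s → Colourable (suc L * 3) k R
-- An edge traversed back and forth counts as a cycle of length 2, so only loops remain and `p`
-- itself is a valid colouring.
coloured L (suc s) {suc zero} 1≤k k<2^ R R? R-sym circ U cov fuel a b p adj = record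
  { colour = p ; fixedˡ = refl ; fixedʳ = refl
  ; isolated = λ u∈ m → subst (Pair a b) (circ-1-loops R-sym circ (proj₁ m)) u∈
  ; bounded = λ v → bounded-edgeless ≤-refl (circ-1-loops R-sym circ) }
coloured {N} L (suc s) {k@(suc (suc j))} 1≤k k<2^ R R? R-sym circ U cov fuel a b p adj
  with circ-or-cycle R? k circ (suc j)
... | inj₁ circ′ = colouring-mono (n≤1+n (suc j))
  (coloured L s (s≤s z≤n) (<⇒≤ k<2^) R R? R-sym circ′ U cov (≤-pred fuel) a b p adj)
... | inj₂ (v , C , pC , unC , j<C) = by-size (k ≤? 3)
  where
  open import Data.List.Membership.DecPropositional (_≟ᶠ_ {N}) using (_∈?_)
  Rest : Fin N → Set
  Rest u = u ∉ C × ¬ Pair a b u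
  Rest? : Decidable Rest
  Rest? u = ¬? (u ∈? C) ×-dec ¬? (pair? a b u)
  2≤k : 2 ≤ k
  2≤k = s≤s (s≤s z≤n)
  C≡k : length C ≡ k
  C≡k = ≤-antisym (circ pC unC) j<C
  below : Below N (suc L * 3) k (length U)
  below R′ R′? R′-sym circ′ U′ cov′ U′<U =
    coloured L s 1≤k k<2^ R′ R′? R′-sym circ′ U′ cov′ (<-≤-trans (+-monoʳ-< k U′<U) (≤-pred fuel))
  small : k ≤ 3 → Colouring (suc L * 3) k R a b p
  small k≤3 with all? (_∈? C) U
  ... | no  U⊈C with u , u∈ , u∉ ← find (¬All⇒Any¬ (_∈? C) U U⊈C) =
    colour-separation₁ R? R-sym circ cov below
      (proj₂ (small-separation R? R-sym cov circ pC unC C≡k 2≤k k≤3 u∈ u∉)) a b p adj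
  ... | yes U⊆C with γ , _ , γ≢pa , γ≢pb , _ ← spare-colours (p a) (p b) =
    colour-layer R-sym p C p 2≤k (≤-reflexive C≡k) γ≢pa γ≢pb (λ r u∉ _ → ⊥-elim (u∉ (All.lookup U⊆C (cov r))))
      λ v → bounded-edgeless 1≤k (λ { (r , (u∉ , _) , _) → ⊥-elim (u∉ (All.lookup U⊆C (cov r))) })
  large : ∀ L → k < 2 ^ (2 + L) → (p : Fin N → Fin (suc L * 3)) → Below N (suc L * 3) k (length U) →
          (∀ L′ → suc L′ ≡ L → ∀ {k} → 1 ≤ k → k < 2 ^ (2 + L′) → (R : Fin N → Fin N → Set) → Decidable₂ R → Symmetric R →
             Circ R k → Covers U R → Colourable (suc L′ * 3) k R) →
          4 ≤ k → Colouring (suc L * 3) k R a b p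
  large zero    k<4  p below rec 4≤k = ⊥-elim (<⇒≱ k<4 4≤k)
  large (suc L) k<2^ p below rec 4≤k
    with circ-or-cycle (restrict? R? Rest?) k (circ-restrict {A = Rest} circ) ⌊ k /2⌋
  ... | inj₁ circ′ with γ , e , γ≢pa , γ≢pb , e-inj , e-fresh ← spare-colours (p a) (p b) =
    colour-layer R-sym p C (e ∘ colour col) 2≤k (≤-reflexive C≡k) γ≢pa γ≢pb (λ _ _ _ → e-fresh _)
      λ v un reach → ≤-trans
        (bounded-transport (λ _ → v ≡ v) (λ { _ (r , eq) → refl , r , e-inj eq }) refl (bounded col v) un reach) (⌊n/2⌋≤n k)
    where
    -- The strengthened statement demands a precoloured vertex; `a` with colour `zero` is a dummy,
    -- isolated in this subgraph.
    col = rec L refl (≤-trans (s≤s z≤n) (⌊n/2⌋-mono 4≤k)) (*-cancelˡ-< 2 _ _ (≤-<-trans (2⌊n/2⌋≤n k) k<2^))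
            _ (restrict? R? Rest?) (restrict-sym Rest R-sym) circ′ (cov ∘ proj₁) a a (const zero) (inj₁ refl)
  ... | inj₂ (w , B , pB , unB , h<B)
    with menger R? (_∈? C) (_∈? B) 3
  ... | inj₂ P = ⊥-elim (long-cycles-unlinked k (length B) h<B
    (subst (λ ℓ → 2 * ℓ + 2 * length B + 6 ≤ k + k + k) C≡k
      (linked-cycles _≟ᶠ_ R-sym circ pC unC (map-walk proj₁ pB) unB (λ { (z∈C , z∈B) → proj₁ (walk-within pB z∈B) z∈C }) P)))
  ... | inj₁ (S , S<3 , sep)
    with x , y , separation ← small-separator-separation R? R-sym unC unB
           -- From `4 ≤ k` and ⌊k/2⌋ < |B| it follows that `B` has at least three vertices.
           (subst (3 ≤_) (sym C≡k) (<⇒≤ 4≤k)) (≤-trans (s≤s (⌊n/2⌋-mono 4≤k)) h<B)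
           (cycle-covered R-sym cov pC) (cycle-covered R-sym cov (map-walk proj₁ pB)) sep S<3 =
    colour-separation R? R-sym circ cov below 2≤k separation a b p adj
  by-size : Dec (k ≤ 3) → Colouring (suc L * 3) k R a b p
  by-size (yes k≤3) = small k≤3
  by-size (no  k≰3) = large L k<2^ p below
    (λ { L′ refl 1≤k k< R R? R-sym circ cov → coloured L′ _ 1≤k k< R R? R-sym circ U cov ≤-refl })
    (≰⇒> k≰3)

-- The logarithm, and passage to graphs

power-bracket : ∀ k → 2 ≤ k → ∃ λ L → 2 ^ suc L ≤ k × k < 2 ^ (2 + L)
power-bracket k 2≤k = search k (<-2^ k)
  where
  <-2^ : ∀ n → n < 2 ^ (2 + n)
  <-2^ zero    = s≤s z≤n
  <-2^ (suc n) = ≤-trans (s≤s (<-2^ n)) (+-mono-≤ (≤-trans (s≤s z≤n) (<-2^ n)) (m≤m+n _ 0))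
  search : ∀ L → k < 2 ^ (2 + L) → ∃ λ L → 2 ^ suc L ≤ k × k < 2 ^ (2 + L)
  search L k< with 2 ^ suc L ≤? k
  ... | yes ≤k = L , ≤k , k<
  search zero    k< | no ≰k = ⊥-elim (≰k 2≤k)
  search (suc L) k< | no ≰k = search L (≰⇒> ≰k)

-- The closed walks of length at most 2, which `Circ` counts but `IsCycle` excludes, are covered by
-- `2 ≤ k`.
cycle-length : ∀ {k} (G : Graph) → 2 ≤ k → CircumferenceAtMost k G → Circ (Edge G) k
cycle-length {k} G 2≤k circ {v} {xs} p un with 3 ≤? length xs
... | no  short = ≤-trans (≤-pred (≰⇒> short)) 2≤k
... | yes long  = bound p un long
  where
  bound : ∀ {xs} → Walk (Edge G) v xs v → Unique xs → 3 ≤ length xs → length xs ≤ k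
  bound (r ∷ p) un long = circ _ (long , un , closed p r)
    where
    closed : ∀ {u ws w x} → Walk (Edge G) u ws w → Edge G w x → Linked (Edge G) (u ∷ ws ++ x ∷ [])
    closed []      r = r ∷ [-]
    closed (s ∷ p) r = s ∷ closed p r

theorem1 : (k : ℕ) → 2 ≤ k → (G : Graph) → CircumferenceAtMost k G →
    Σ ℕ (λ c → (c ≤ ⌊log₂ (k ^ 3) ⌋) ×
    Σ (Fin (n G) → Fin c) (λ f → (v : Fin (n G)) → ComponentOrderAtMost G f v k))
theorem1 k 2≤k G circ with L , ≤k , k< ← power-bracket k 2≤k = suc L * 3 , few , colour-graph
  where
  -- For an integer, being at most 3 log₂ k means being at most ⌊log₂ k³⌋; here k³ is at least 2 to
  -- the power of the number of colours.
  few : suc L * 3 ≤ ⌊log₂ (k ^ 3) ⌋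
  few = subst (_≤ ⌊log₂ (k ^ 3) ⌋) (trans (cong ⌊log₂_⌋ (^-*-assoc 2 (suc L) 3)) (⌊log₂[2^n]⌋≡n (suc L * 3)))
    (⌊log₂⌋-mono-≤ (^-monoˡ-≤ 3 ≤k))
  colour-graph : Σ (Fin (n G) → Fin (suc L * 3)) (λ f → (v : Fin (n G)) → ComponentOrderAtMost G f v k)
  colour-graph with any? {n = n G} (λ _ → yes tt)
  -- Without vertices there is nothing to precolour, so the induction does not apply.
  ... | no  empty   = (λ v → ⊥-elim (empty (v , tt))) , λ v → ⊥-elim (empty (v , tt))
  ... | yes (a , _) = colour col , λ v us un reach → bounded col v un λ w∈ → to-walk (All.lookup reach w∈)
    where
    E-sym : Symmetric (Edge G)
    E-sym {u} {v} = subst T (symm G u v)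
    col : Colouring (suc L * 3) k (Edge G) a a (const zero)
    col = coloured L _ (<⇒≤ 2≤k) k< (Edge G) (λ u v → T? (adj G u v)) E-sym (cycle-length G 2≤k circ)
            (allFin (n G)) (λ _ → ∈-allFin _) ≤-refl a a (const zero) (inj₁ refl)
    to-walk : ∀ {u w} → MonoReach G (colour col) u w → ∃ λ xs → Walk (Mono (Edge G) (colour col)) u xs w
    to-walk (here v)             = [] , []
    to-walk (step u w v e eq m) with xs , p ← to-walk m = w ∷ xs , (e , eq) ∷ p
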